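{- Let $\mathcal{L}_{BC}$ be the language of Boolean circuits. For a parametrised propositional logic program $\mathcal{P}$ over a finite alphabet $\Sigma=\Sigma_p\cup\Sigma_d$, the algorithm $\mathrm{Compile}(\mathcal{L}_{BC})$ (i) runs in time polynomial in the size of $\mathcal{P}$, and (ii) produces an output circuit whose size is polynomial in the size of $\mathcal{P}$.
   Context: A parametrised logic program is a finite set of rules $h\leftarrow l_1\wedge\dots\wedge l_n$ with $h\in\Sigma_d$ and each $l_i$ an atom of $\Sigma$ or its negation; $\varphi_q$ is the disjunction of bodies of rules with head $q$. $L_p$: equivalence classes of propositional formulas over $\Sigma_p$ ordered by entailment; $L^d_p$: maps $\Sigma_d\to L_p$ ordered pointwise. For $\mathcal{S}=(\mathcal{A}_t,\mathcal{A}_p)\in(L^d_p)^2$, $\varphi^{\mathcal{S}}$ is obtained by substituting $(\overline q,\overline q)$ for $q\in\Sigma_p$ and $(\mathcal{A}_t(q),\mathcal{A}_p(q))$ for $q\in\Sigma_d$, with $\wedge,\vee$ componentwise and $(\neg\psi)^{\mathcal{S}}=(\overline{\neg\psi_p},\overline{\neg\psi_t})$; $\Psi_{\mathcal{P}}(\mathcal{S})(q)=\varphi_q^{\mathcal{S}}$. Algorithm $\mathrm{Compile}(\mathcal{L}_{BC})$: a state assigns to each $q\in\Sigma_d$ two Boolean circuits $\mathfrak{S}_t(q),\mathfrak{S}_p(q)$ over $\Sigma_p$, representing the partial symbolic interpretation $\mathcal{S}_{\mathfrak{S}}$ mapping $q$ to $(\overline{\mathfrak{S}_t(q)},\overline{\mathfrak{S}_p(q)})$.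 The initial state is $(\mathbf{f},\mathbf{t})$ for every atom. Transitions are maximally precise $\Psi_{\mathcal{P}}$-refinements: an application refinement replaces $\mathcal{S}$ by $\Psi_{\mathcal{P}}(\mathcal{S})$ (building new gates on top of the existing circuits), and an unfoundedness refinement replaces $(x,y)$ by $(x,y')$ with $y'=\mathrm{lfp}(y''\mapsto\Psi_{\mathcal{P}}(x,y'')_2)$; application refinements are given priority over unfoundedness refinements, and the process continues until no strict refinement exists. The output is a circuit representing $\mathrm{Th}(\mathcal{A})=\bigwedge_{q\in\Sigma_d}(q\leftrightarrow\psi_q)$ for the resulting symbolic interpretation $\mathcal{A}$ (the parametrised well-founded model, i.e. the least precise pair $(x,y)$ with $x=\mathrm{lfp}(\Psi_{\mathcal{P}}(\cdot,y)_1)$, $y=\mathrm{lfp}(\Psi_{\mathcal{P}}(x,\cdot)_2)$). -}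

module Defs where

open import Data.Bool using (Bool; true; false; not; _∧_; _∨_; T)
open import Data.Fin using (Fin; toℕ)
import Data.Fin as Fin
open import Data.List using (List; []; _∷_; foldr; map; filter; length; sum; allFin)
open import Data.List.Membership.Propositional using (_∈_)
open import Data.List.Relation.Unary.All using (All; []; _∷_)
import Data.List.Relation.Unary.All as All
open import Data.Nat using (ℕ; zero; suc; _+_; _*_; _^_; _<_; _≟_)
open import Data.Product using (∃-syntax; _×_; _,_; proj₁; proj₂)
open import Data.Sum using (_⊎_; inj₁; inj₂)
open import Data.Unit using (⊤; tt)
open import Data.Vec using (Vec; []; _∷_; lookup; replicate)
open import Function using (_∘_)
open import Relation.Binary.PropositionalEquality using (_≡_)
open import Relation.Nullary using (¬_; yes; no)

------------------------------------------------------------------------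
-- Propositional formulas

infixr 7 _⩓_
infixr 6 _⩔_
infix  5 _⇿_

data Formula (A : Set) : Set where
  ff tt    : Formula A
  atom     : A → Formula A
  ∼_       : Formula A → Formula A
  _⩓_ _⩔_  : Formula A → Formula A → Formula A

⋀ ⋁ : ∀ {A} → List (Formula A) → Formula A
⋀ = foldr _⩓_ tt
⋁ = foldr _⩔_ ff

_⇿_ : ∀ {A} → Formula A → Formula A → Formula A
φ ⇿ ψ = (φ ⩓ ψ) ⩔ (∼ φ ⩓ ∼ ψ)

mapF : ∀ {A B} → (A → B) → Formula A → Formula B
mapF f ff       = ff
mapF f tt       = tt
mapF f (atom a) = atom (f a)
mapF f (∼ φ)    = ∼ mapF f φ
mapF f (φ ⩓ ψ)  = mapF f φ ⩓ mapF f ψ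
mapF f (φ ⩔ ψ)  = mapF f φ ⩔ mapF f ψ

eval : ∀ {A} → (A → Bool) → Formula A → Bool
eval v ff       = false
eval v tt       = true
eval v (atom a) = v a
eval v (∼ φ)    = not (eval v φ)
eval v (φ ⩓ ψ)  = eval v φ ∧ eval v ψ
eval v (φ ⩔ ψ)  = eval v φ ∨ eval v ψ

-- L_p is represented as the preorder of formulas under entailment; equality of
-- equivalence classes is _≈_.
infix 4 _⊨_ _≈_

_⊨_ _≈_ : ∀ {A} → Formula A → Formula A → Set
φ ⊨ ψ = ∀ v → T (eval v φ) → T (eval v ψ)
φ ≈ ψ = φ ⊨ ψ × ψ ⊨ φ

------------------------------------------------------------------------
-- Parametrised logic programs over Σ_p = Fin m and Σ_d = Fin n

data Atom (m n : ℕ) : Set where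
  par : Fin m → Atom m n
  def : Fin n → Atom m n

data Literal (m n : ℕ) : Set where
  pos neg : Atom m n → Literal m n

record Rule (m n : ℕ) : Set where
  constructor _⟵_
  field
    head : Fin n
    body : List (Literal m n)

open Rule public

-- The order of the rules and repetitions among them have no meaning.
Program : ℕ → ℕ → Set
Program m n = List (Rule m n)

-- Every atom of the alphabet counts, also one that occurs in no rule: the
-- theory Th(𝒜) has a conjunct for each q ∈ Σ_d.
sizeP : ∀ {m n} → Program m n → ℕ
sizeP {m} {n} P = m + n + sum (map (λ r → suc (length (body r))) P)

litF : ∀ {m n} → Literal m n → Formula (Atom m n)
litF (pos a) = atom a
litF (neg a) = ∼ atom a

φ[_] : ∀ {m n} → Program m n → Fin n → Formula (Atom m n)
φ[ P ] q = ⋁ (map (⋀ ∘ map litF ∘ body) (filter (λ r → head r Fin.≟ q) P))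

------------------------------------------------------------------------
-- Partial symbolic interpretations and the operator Ψ

Symbolic Partial : ℕ → ℕ → Set
Symbolic m n = Fin n → Formula (Fin m)
Partial m n = Symbolic m n × Symbolic m n

infix 4 _≤ˢ_ _≈ˢ_ _≤ₚ_ _≈ₚ_ _<ₚ_

_≤ˢ_ _≈ˢ_ : ∀ {m n} → Symbolic m n → Symbolic m n → Set
x ≤ˢ y = ∀ q → x q ⊨ y q
x ≈ˢ y = ∀ q → x q ≈ y q

_≤ₚ_ _≈ₚ_ _<ₚ_ : ∀ {m n} → Partial m n → Partial m n → Set
(x , y) ≤ₚ (x′ , y′) = x ≤ˢ x′ × y′ ≤ˢ y
(x , y) ≈ₚ (x′ , y′) = x ≈ˢ x′ × y ≈ˢ y′
S <ₚ S′ = S ≤ₚ S′ × ¬ (S ≈ₚ S′)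

-- φ^𝒮. The leaves are formulas over an arbitrary X, because the same
-- substitution is used for L_p and for the wires of a circuit.
substitute : ∀ {m n} {X : Set} →
             (Fin m → Formula X) → (Fin n → Formula X × Formula X) →
             Formula (Atom m n) → Formula X × Formula X
substitute p d ff             = ff , ff
substitute p d tt             = tt , tt
substitute p d (atom (par q)) = p q , p q
substitute p d (atom (def q)) = d q
substitute p d (∼ φ)          =
  let (φₜ , φₚ) = substitute p d φ in ∼ φₚ , ∼ φₜ
substitute p d (φ ⩓ ψ)        =
  let (φₜ , φₚ) = substitute p d φ
      (ψₜ , ψₚ) = substitute p d ψ
  in φₜ ⩓ ψₜ , φₚ ⩓ ψₚ
substitute p d (φ ⩔ ψ)        =
  let (φₜ , φₚ) = substitute p d φ
      (ψₜ , ψₚ) = substitute p d ψ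
  in φₜ ⩔ ψₜ , φₚ ⩔ ψₚ

Ψ : ∀ {m n} → Program m n → Partial m n → Partial m n
Ψ P (x , y) = (λ q → proj₁ (value q)) , (λ q → proj₂ (value q))
  where value = λ q → substitute atom (λ r → x r , y r) (φ[ P ] q)

IsLfp : ∀ {m n} → (Symbolic m n → Symbolic m n) → Symbolic m n → Set
IsLfp f x = f x ≈ˢ x × (∀ z → f z ≈ˢ z → x ≤ˢ z)

IsStable : ∀ {m n} → Program m n → Partial m n → Set
IsStable P (x , y) = IsLfp (λ x′ → proj₁ (Ψ P (x′ , y))) x
                   × IsLfp (λ y′ → proj₂ (Ψ P (x , y′))) y

IsWellFoundedModel : ∀ {m n} → Program m n → Partial m n → Set
IsWellFoundedModel P S = IsStable P S × (∀ S′ → IsStable P S′ → S ≤ₚ S′)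

Th : ∀ {m n} → Symbolic m n → Formula (Atom m n)
Th {n = n} A = ⋀ (map (λ q → atom (def q) ⇿ mapF par (A q)) (allFin n))

------------------------------------------------------------------------
-- Boolean circuits

-- Gates are listed newest first, and a gate is named by the number of gates
-- older than it, so that names survive the addition of new gates.
data Gate (I : Set) : Set where
  input : I → Gate I
  const : Bool → Gate I
  inv   : ℕ → Gate I
  and   : ℕ → ℕ → Gate I
  or    : ℕ → ℕ → Gate I

Gates : Set → Set
Gates I = List (Gate I)

record Circuit (I : Set) : Set where
  constructor circuit
  field
    gates  : Gates I
    output : ℕ

open Circuit public

WellWired : ∀ {I} → ℕ → Gate I → Set
WellWired k (input i) = ⊤
WellWired k (const b) = ⊤
WellWired k (inv r)   = r < k
WellWired k (and r s) = r < k × s < k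
WellWired k (or r s)  = r < k × s < k

AllWellWired : ∀ {I} → Gates I → Set
AllWellWired []      = ⊤
AllWellWired (g ∷ c) = WellWired (length c) g × AllWellWired c

WellFormed : ∀ {I} → Circuit I → Set
WellFormed C = AllWellWired (gates C) × output C < length (gates C)

gateSize : ∀ {I} → Gate I → ℕ
gateSize (input i) = 1
gateSize (const b) = 1
gateSize (inv r)   = 2
gateSize (and r s) = 3
gateSize (or r s)  = 3

-- The number of gates and wires.
sizeC : ∀ {I} → Circuit I → ℕ
sizeC C = sum (map gateSize (gates C))

mapG : ∀ {I J} → (I → J) → Gate I → Gate J
mapG f (input i) = input (f i)
mapG f (const b) = const b
mapG f (inv r)   = inv r
mapG f (and r s) = and r s
mapG f (or r s)  = or r s

-- The formula computed at a gate. The value ff for a name that denotes no gate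
-- is a dummy: it does not arise in well-formed circuits.
formulaAt : ∀ {I} → Gates I → ℕ → Formula I
formulaAt []      r = ff
formulaAt (g ∷ c) r with r ≟ length c
... | no  _ = formulaAt c r
... | yes _ = at g
  where
  at : Gate _ → Formula _
  at (input i)     = atom i
  at (const true)  = tt
  at (const false) = ff
  at (inv s)       = ∼ formulaAt c s
  at (and s t)     = formulaAt c s ⩓ formulaAt c t
  at (or s t)      = formulaAt c s ⩔ formulaAt c t

data Leaf (I : Set) : Set where
  wire : ℕ → Leaf I
  inp  : I → Leaf I

add : ∀ {I} → Gate I → Gates I → Gates I × ℕ
add g c = g ∷ c , length c

-- Adds one gate per connective, constant and input occurrence; existing gates
-- are reused through wires.
build : ∀ {I} → Formula (Leaf I) → Gates I → Gates I × ℕ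
build ff              c = add (const false) c
build tt              c = add (const true) c
build (atom (wire r)) c = c , r
build (atom (inp i))  c = add (input i) c
build (∼ φ)           c = let (c₁ , r) = build φ c in add (inv r) c₁
build (φ ⩓ ψ)         c =
  let (c₁ , s) = build ψ c
      (c₂ , r) = build φ c₁
  in add (and r s) c₂
build (φ ⩔ ψ)         c =
  let (c₁ , s) = build ψ c
      (c₂ , r) = build φ c₁
  in add (or r s) c₂

buildAll : ∀ {I k} → (Fin k → Formula (Leaf I)) → Gates I → Gates I × Vec ℕ k
buildAll {k = zero}  φ c = c , []
buildAll {k = suc k} φ c =
  let (c₁ , rs) = buildAll (φ ∘ Fin.suc) c
      (c₂ , r)  = build (φ Fin.zero) c₁
  in c₂ , r ∷ rs

------------------------------------------------------------------------
-- Compile(L_BC)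

-- The circuits of a state share one list of gates; 𝔖ₜ and 𝔖ₚ name their outputs.
record State (m n : ℕ) : Set where
  constructor state
  field
    pool  : Gates (Fin m)
    𝔖ₜ 𝔖ₚ : Vec ℕ n

open State public

⟦_⟧ : ∀ {m n} → State m n → Partial m n
⟦ S ⟧ = (λ q → formulaAt (pool S) (lookup (𝔖ₜ S) q))
      , (λ q → formulaAt (pool S) (lookup (𝔖ₚ S) q))

initial : ∀ {m n} → State m n
initial {n = n} =
  let (c₁ , f) = add (const false) []
      (c₂ , t) = add (const true) c₁
  in state c₂ (replicate n f) (replicate n t)

-- φ_q^𝒮 with the circuits named by xs, ys substituted for the defined atoms.
wired : ∀ {m n} → Program m n → Vec ℕ n → Vec ℕ n →
        Fin n → Formula (Leaf (Fin m)) × Formula (Leaf (Fin m))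
wired P xs ys q =
  substitute (atom ∘ inp)
             (λ r → atom (wire (lookup xs r)) , atom (wire (lookup ys r)))
             (φ[ P ] q)

applied : ∀ {m n} → Program m n → State m n → State m n
applied P (state c xs ys) =
  let (c₁ , xs′) = buildAll (proj₁ ∘ wired P xs ys) c
      (c₂ , ys′) = buildAll (proj₂ ∘ wired P xs ys) c₁
  in state c₂ xs′ ys′

-- The k-th iterate of y″ ↦ Ψ(x , y″)₂ from the bottom element.
iterated : ∀ {m n} → Program m n → Vec ℕ n → ℕ → Gates (Fin m) →
           Gates (Fin m) × Vec ℕ n
iterated {n = n} P xs zero    c =
  let (c₁ , f) = add (const false) c in c₁ , replicate n f
iterated         P xs (suc k) c =
  let (c₁ , ys) = iterated P xs k c in buildAll (proj₂ ∘ wired P xs ys) c₁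

refounded : ∀ {m n} → Program m n → State m n → ℕ → State m n
refounded P (state c xs ys) k =
  let (c₁ , ys′) = iterated P xs k c in state c₁ xs ys′

record Application {m n} (P : Program m n) (S S′ : State m n) : Set where
  field
    constructed : S′ ≡ applied P S
    represents  : ⟦ S′ ⟧ ≈ₚ Ψ P ⟦ S ⟧
    refines     : ⟦ S ⟧ ≤ₚ ⟦ S′ ⟧

-- The upper bound of S′ is the least fixpoint for the lower bound of S.
Founded : ∀ {m n} → Program m n → State m n → State m n → Set
Founded P S S′ = IsLfp (λ y → proj₂ (Ψ P (proj₁ ⟦ S ⟧ , y))) (proj₂ ⟦ S′ ⟧)

record Unfoundedness {m n} (P : Program m n) (S S′ : State m n) : Set where
  field
    iterations  : ℕ
    constructed : S′ ≡ refounded P S iterations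
    unchanged   : proj₁ ⟦ S′ ⟧ ≈ˢ proj₁ ⟦ S ⟧
    founded     : Founded P S S′
    refines     : ⟦ S ⟧ ≤ₚ ⟦ S′ ⟧

open Unfoundedness public using (iterations)

NoStrictApplication NoStrictUnfoundedness Terminal :
  ∀ {m n} → Program m n → State m n → Set
NoStrictApplication P S   = ∀ S′ → Application P S S′ → ¬ (⟦ S ⟧ <ₚ ⟦ S′ ⟧)
NoStrictUnfoundedness P S = ∀ S′ → Unfoundedness P S S′ → ¬ (⟦ S ⟧ <ₚ ⟦ S′ ⟧)
Terminal P S              = NoStrictApplication P S × NoStrictUnfoundedness P S

-- Refinements in a run need not be strict. Whether a refinement is strict is a
-- question of circuit equivalence; an implementation may avoid it by refining
-- often enough to be certain that the state is terminal.
data Run {m n} (P : Program m n) : State m n → Set where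
  start   : Run P initial
  apply   : ∀ {S S′} → Run P S → Application P S S′ → Run P S′
  refound : ∀ {S S′} → Run P S → NoStrictApplication P S →
            Unfoundedness P S S′ → Run P S′

-- Runs without superfluous refinements or fixpoint iterations.
Economical : ∀ {m n} {P : Program m n} {S} → Run P S → Set
Economical start = ⊤
Economical (apply {S} {S′} ρ _) = Economical ρ × ⟦ S ⟧ <ₚ ⟦ S′ ⟧
Economical {P = P} (refound {S} {S′} ρ _ u) =
  Economical ρ × ⟦ S ⟧ <ₚ ⟦ S′ ⟧ ×
  (∀ j → j < iterations u → ¬ Founded P S (refounded P S j))

-- The number of transitions, each fixpoint iteration counting as one more.
steps : ∀ {m n} {P : Program m n} {S} → Run P S → ℕ
steps start           = 0
steps (apply ρ _)     = suc (steps ρ)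
steps (refound ρ _ u) = suc (iterations u) + steps ρ

-- The circuit for Th(𝒜), with ψ_q given by 𝔖ₜ(q). When the final state is exact,
-- 𝔖ₜ(q) and 𝔖ₚ(q) are equivalent.
theory : ∀ {m n} → State m n → Circuit (Atom m n)
theory {m} {n} S =
  let (c , r) = build (⋀ (map (λ q → atom (inp (def q)) ⇿ atom (wire (lookup (𝔖ₜ S) q)))
                              (allFin n)))
                      (map (mapG par) (pool S))
  in circuit c r

record Compile {m n} (P : Program m n) (C : Circuit (Atom m n)) : Set where
  field
    final       : State m n
    run         : Run P final
    terminal    : Terminal P final
    model       : IsWellFoundedModel P ⟦ final ⟧
    constructed : C ≡ theory final
    wellFormed  : WellFormed C
    represents  : formulaAt (gates C) (output C) ≈ Th (proj₁ ⟦ final ⟧)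

------------------------------------------------------------------------
-- The model of computation

-- A first-order language of immutable linked data with primitive recursion.
-- Every operation allocates, reads or copies a bounded number of cells, so a
-- computation of cost t takes time polynomial in t on a Turing machine.

infixr 6 _⊗_
infixr 5 _⊕_

data Ty : Set where
  unit nat : Ty
  list     : Ty → Ty
  _⊗_ _⊕_  : Ty → Ty → Ty

Val : Ty → Set
Val unit     = ⊤
Val nat      = ℕ
Val (list A) = List (Val A)
Val (A ⊗ B)  = Val A × Val B
Val (A ⊕ B)  = Val A ⊎ Val B

infix 3 _⊢_

data _⊢_ (Γ : List Ty) : Ty → Set where
  var     : ∀ {A} → A ∈ Γ → Γ ⊢ A
  bind    : ∀ {A B} → Γ ⊢ A → A ∷ Γ ⊢ B → Γ ⊢ B
  unit    : Γ ⊢ unit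
  pair    : ∀ {A B} → Γ ⊢ A → Γ ⊢ B → Γ ⊢ A ⊗ B
  fst     : ∀ {A B} → Γ ⊢ A ⊗ B → Γ ⊢ A
  snd     : ∀ {A B} → Γ ⊢ A ⊗ B → Γ ⊢ B
  inl     : ∀ {A B} → Γ ⊢ A → Γ ⊢ A ⊕ B
  inr     : ∀ {A B} → Γ ⊢ B → Γ ⊢ A ⊕ B
  case    : ∀ {A B D} → Γ ⊢ A ⊕ B → A ∷ Γ ⊢ D → B ∷ Γ ⊢ D → Γ ⊢ D
  zero    : Γ ⊢ nat
  suc     : Γ ⊢ nat → Γ ⊢ nat
  recNat  : ∀ {D} → Γ ⊢ nat → Γ ⊢ D → D ∷ nat ∷ Γ ⊢ D → Γ ⊢ D
  nil     : ∀ {A} → Γ ⊢ list A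
  cons    : ∀ {A} → Γ ⊢ A → Γ ⊢ list A → Γ ⊢ list A
  recList : ∀ {A D} → Γ ⊢ list A → Γ ⊢ D → D ∷ A ∷ list A ∷ Γ ⊢ D → Γ ⊢ D

Env : List Ty → Set
Env = All Val

primNat : {D : Set} → D → (ℕ → D → D) → ℕ → D
primNat z s zero    = z
primNat z s (suc k) = s k (primNat z s k)

primList : {A D : Set} → D → (A → List A → D → D) → List A → D
primList z s []       = z
primList z s (a ∷ as) = s a as (primList z s as)

result : ∀ {Γ A} → Γ ⊢ A → Env Γ → Val A
result (var i)         ε = All.lookup ε i
result (bind e f)      ε = result f (result e ε ∷ ε)
result unit            ε = tt
result (pair e f)      ε = result e ε , result f ε
result (fst e)         ε = proj₁ (result e ε)
result (snd e)         ε = proj₂ (result e ε)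
result (inl e)         ε = inj₁ (result e ε)
result (inr e)         ε = inj₂ (result e ε)
result (case e f g)    ε with result e ε
... | inj₁ a = result f (a ∷ ε)
... | inj₂ b = result g (b ∷ ε)
result zero            ε = zero
result (suc e)         ε = suc (result e ε)
result (recNat e z s)  ε =
  primNat (result z ε) (λ k d → result s (d ∷ k ∷ ε)) (result e ε)
result nil             ε = []
result (cons e f)      ε = result e ε ∷ result f ε
result (recList e z s) ε =
  primList (result z ε) (λ a as d → result s (d ∷ a ∷ as ∷ ε)) (result e ε)

-- The number of term nodes evaluated, under call by value.
cost : ∀ {Γ A} → Γ ⊢ A → Env Γ → ℕ
cost (var i)         ε = 1
cost (bind e f)      ε = 1 + cost e ε + cost f (result e ε ∷ ε)
cost unit            ε = 1
cost (pair e f)      ε = 1 + cost e ε + cost f ε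
cost (fst e)         ε = 1 + cost e ε
cost (snd e)         ε = 1 + cost e ε
cost (inl e)         ε = 1 + cost e ε
cost (inr e)         ε = 1 + cost e ε
cost (case e f g)    ε with result e ε
... | inj₁ a = 1 + cost e ε + cost f (a ∷ ε)
... | inj₂ b = 1 + cost e ε + cost g (b ∷ ε)
cost zero            ε = 1
cost (suc e)         ε = 1 + cost e ε
cost (recNat e z s)  ε = 1 + cost e ε +
  primNat (cost z ε)
          (λ k t → t + cost s (primNat (result z ε) (λ j d → result s (d ∷ j ∷ ε)) k ∷ k ∷ ε))
          (result e ε)
cost nil             ε = 1
cost (cons e f)      ε = 1 + cost e ε + cost f ε
cost (recList e z s) ε = 1 + cost e ε +
  primList (cost z ε)
           (λ a as t → t + cost s (primList (result z ε) (λ b bs d → result s (d ∷ b ∷ bs ∷ ε)) as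
                                   ∷ a ∷ as ∷ ε))
           (result e ε)

------------------------------------------------------------------------
-- Programs and circuits as data

boolTy atomTy literalTy ruleTy programTy gateTy circuitTy : Ty
boolTy    = unit ⊕ unit
atomTy    = nat ⊕ nat
literalTy = atomTy ⊕ atomTy
ruleTy    = nat ⊗ list literalTy
programTy = nat ⊗ nat ⊗ list ruleTy
gateTy    = atomTy ⊕ boolTy ⊕ nat ⊕ nat ⊗ nat ⊕ nat ⊗ nat
circuitTy = list gateTy ⊗ nat

encodeBool : Bool → Val boolTy
encodeBool false = inj₁ tt
encodeBool true  = inj₂ tt

encodeAtom : ∀ {m n} → Atom m n → Val atomTy
encodeAtom (par q) = inj₁ (toℕ q)
encodeAtom (def q) = inj₂ (toℕ q)

encodeLiteral : ∀ {m n} → Literal m n → Val literalTy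
encodeLiteral (pos a) = inj₁ (encodeAtom a)
encodeLiteral (neg a) = inj₂ (encodeAtom a)

encodeProgram : ∀ {m n} → Program m n → Val programTy
encodeProgram {m} {n} P =
  m , n , map (λ r → toℕ (head r) , map encodeLiteral (body r)) P

encodeGate : ∀ {m n} → Gate (Atom m n) → Val gateTy
encodeGate (input a) = inj₁ (encodeAtom a)
encodeGate (const b) = inj₂ (inj₁ (encodeBool b))
encodeGate (inv r)   = inj₂ (inj₂ (inj₁ r))
encodeGate (and r s) = inj₂ (inj₂ (inj₂ (inj₁ (r , s))))
encodeGate (or r s)  = inj₂ (inj₂ (inj₂ (inj₂ (r , s))))

encodeCircuit : ∀ {m n} → Circuit (Atom m n) → Val circuitTy
encodeCircuit C = map encodeGate (gates C) , output C

Implementation : Set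
Implementation = programTy ∷ [] ⊢ circuitTy

resultOn : ∀ {m n} → Implementation → Program m n → Val circuitTy
resultOn e P = result e (encodeProgram P ∷ [])

timeOn : ∀ {m n} → Implementation → Program m n → ℕ
timeOn e P = cost e (encodeProgram P ∷ [])

-- A common form of polynomial bounds: every polynomial in s is at most
-- poly c k s for suitable c and k.
poly : ℕ → ℕ → ℕ → ℕ
poly c k s = c * s ^ k + c

{-# OPTIONS --safe #-}
module Submission where

-- At a fixed valuation v of the parameters a symbolic state is a pair (X , Y)
-- of subsets of Σ_d, and refinements can raise its precision ∣X∣ + ∣Σ_d ∖ Y∣
-- at most 2n times. Both kinds of refinement act on all valuations at once.
-- A valuation left unchanged by one application is left unchanged by the
-- following ones, hence 2n applications in a row stabilise every valuation. As
-- unfoundedness refinements happen only in application-stable states, one that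
-- leaves v unchanged shows that v is settled for good; hence 2n rounds settle
-- every valuation. Least fixpoints are reached in n iterations, and each
-- application or iteration adds a number of gates polynomial in the program.
--
-- The implementation makes 2n rounds of 2n applications and one unfoundedness
-- refinement, which needs no test of circuit equivalence. All its recursions
-- run over data of length at most 2s for a program of size s, and the cost of a
-- term is then bounded by a polynomial in s read off its syntax.

open import Defs
open import Data.Bool using (Bool; true; false; not; _∧_; _∨_; T)
open import Data.Empty using (⊥-elim)
open import Data.Fin using (Fin; toℕ)
import Data.Fin as Fin
open import Data.Fin.Properties using (toℕ<n; toℕ-injective)
open import Data.List using (List; []; _∷_; map; length; allFin; drop)
import Data.List as List
open import Data.List.Membership.Propositional using (_∈_)
open import Data.List.Properties using (length-drop; length-map; length-tabulate; map-cong; map-id; map-tabulate; map-∘)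
open import Data.List.Relation.Unary.All using (All; []; _∷_)
import Data.List.Relation.Unary.All as All
open import Data.List.Relation.Unary.Any using (here; there)
open import Data.Nat using (ℕ; zero; suc; pred; _+_; _*_; _∸_; _^_; _≤_; _<_; _≤?_; _≟_; z≤n; s≤s)
open import Data.Nat.Properties
open import Data.Product using (∃-syntax; Σ-syntax; _×_; _,_; proj₁; proj₂; swap)
open import Data.Sum using (_⊎_; inj₁; inj₂)
open import Data.Unit using (⊤; tt)
open import Data.Vec using (Vec; []; _∷_; lookup; replicate; toList)
open import Data.Vec.Properties using (length-toList; lookup-replicate)
open import Function using (_∘_; id)
open import Relation.Binary.PropositionalEquality using (_≡_; _≗_; refl; sym; trans; cong; cong₂; subst)
open import Relation.Nullary using (¬_; yes; no; does)
open import Relation.Nullary.Decidable using (decidable-stable; T?)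

-- The obstacle is the height of the symbolic order: each defined atom carries a Boolean function of
-- `m` parameters, so the order admits strictly increasing chains of length `2 * n * 2 ^ m`, and a
-- strict refinement is only certain to move one valuation. Counting strict refinements in that
-- order gives no polynomial bound. Instead a dichotomy is carried along the run for every valuation
-- separately: either it has gained precision in every counted step, or it is already stable. After
-- `n + n` counted steps the first alternative has used up all its room, so every valuation is
-- stable, however different their histories were.
--
-- The two halves of the theorem use this in opposite directions. In an economical run stability
-- contradicts strictness of the next refinement, which bounds the number of refinements.

private variable
  I J : Set
  Γ : List Ty
  A B D : Ty

-- Pointwise order of Boolean assignments

Assignment : ℕ → Set
Assignment n = Fin n → Bool

infix 4 _⊆_

_⊆_ : ∀ {n} → Assignment n → Assignment n → Set
X ⊆ Y = ∀ q → T (X q) → T (Y q)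

⊆-trans : ∀ {n} {X Y Z : Assignment n} → X ⊆ Y → Y ⊆ Z → X ⊆ Z
⊆-trans f g q = g q ∘ f q

≗⇒⊆ : ∀ {n} {X Y : Assignment n} → X ≗ Y → X ⊆ Y
≗⇒⊆ e q = subst T (e q)

≗⇒⊇ : ∀ {n} {X Y : Assignment n} → X ≗ Y → Y ⊆ X
≗⇒⊇ e q = subst T (sym (e q))

bit : Bool → ℕ
bit false = 0
bit true  = 1

bit≤1 : ∀ a → bit a ≤ 1
bit≤1 false = z≤n
bit≤1 true  = ≤-refl

bit-mono : ∀ a b → (T a → T b) → bit a ≤ bit b
bit-mono false b     f = z≤n
bit-mono true  true  f = ≤-refl
bit-mono true  false f = ⊥-elim (f tt)

bit-reflects : ∀ a b → bit a ≤ bit b → T a → T b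
bit-reflects true true _ _ = tt

count : ∀ {n} → Assignment n → ℕ
count {zero}  X = 0
count {suc n} X = bit (X Fin.zero) + count (X ∘ Fin.suc)

count≤n : ∀ {n} (X : Assignment n) → count X ≤ n
count≤n {zero}  X = z≤n
count≤n {suc n} X = +-mono-≤ (bit≤1 (X Fin.zero)) (count≤n (X ∘ Fin.suc))

count-mono : ∀ {n} {X Y : Assignment n} → X ⊆ Y → count X ≤ count Y
count-mono {zero}  f = z≤n
count-mono {suc n} f = +-mono-≤ (bit-mono _ _ (f Fin.zero)) (count-mono (f ∘ Fin.suc))

+-reflects-≤ : ∀ {a b c d} → a ≤ b → c ≤ d → b + d ≤ a + c → b ≤ a × d ≤ c
+-reflects-≤ {a} {b} {c} {d} a≤b c≤d h =
  +-cancelʳ-≤ d b a (≤-trans h (+-monoʳ-≤ a c≤d)) ,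
  +-cancelˡ-≤ a d c (≤-trans (+-monoˡ-≤ d a≤b) h)

count-reflects : ∀ {n} {X Y : Assignment n} → X ⊆ Y → count Y ≤ count X → Y ⊆ X
count-reflects {suc n} f h q
  with +-reflects-≤ (bit-mono _ _ (f Fin.zero)) (count-mono (f ∘ Fin.suc)) h | q
... | h₀ , _ | Fin.zero   = bit-reflects _ _ h₀
... | _ , h₁ | Fin.suc q′ = count-reflects (f ∘ Fin.suc) h₁ q′

-- Precision order of pairs of assignments

Approx : ℕ → Set
Approx n = Assignment n × Assignment n

infix 4 _⊑_ _≅_

_⊑_ _≅_ : ∀ {n} → Approx n → Approx n → Set
(X , Y) ⊑ (X′ , Y′) = X ⊆ X′ × Y′ ⊆ Y
A ≅ B = A ⊑ B × B ⊑ A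

⊑-trans : ∀ {n} {A B C : Approx n} → A ⊑ B → B ⊑ C → A ⊑ C
⊑-trans (f , g) (f′ , g′) = ⊆-trans f f′ , ⊆-trans g′ g

-- Each inclusion is a statement about single bits, hence decidable. This turns negative hypotheses
-- such as `NoStrictApplication` into inequalities.
⊑-stable : ∀ {n} {A B : Approx n} → ¬ ¬ (A ⊑ B) → A ⊑ B
⊑-stable ¬¬p =
  (λ q t → decidable-stable (T? _) (λ ¬t → ¬¬p (λ p → ¬t (proj₁ p q t)))) ,
  (λ q t → decidable-stable (T? _) (λ ¬t → ¬¬p (λ p → ¬t (proj₂ p q t))))

precision : ∀ {n} → Approx n → ℕ
precision (X , Y) = count X + count (not ∘ Y)

precision≤n+n : ∀ {n} (A : Approx n) → precision A ≤ n + n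
precision≤n+n (X , Y) = +-mono-≤ (count≤n X) (count≤n (not ∘ Y))

not-antitone : ∀ a b → (T a → T b) → T (not b) → T (not a)
not-antitone false b    f _ = tt
not-antitone true false f _ = f tt

not-reflects : ∀ a b → (T (not b) → T (not a)) → T a → T b
not-reflects true true  f _ = tt
not-reflects true false f _ = f tt

precision-mono : ∀ {n} {A B : Approx n} → A ⊑ B → precision A ≤ precision B
precision-mono (f , g) =
  +-mono-≤ (count-mono f) (count-mono (λ q → not-antitone _ _ (g q)))

precision-reflects : ∀ {n} {A B : Approx n} → A ⊑ B → precision B ≤ precision A → B ⊑ A
precision-reflects (f , g) h
  with +-reflects-≤ (count-mono f) (count-mono (λ q → not-antitone _ _ (g q))) h
... | h₁ , h₂ =
  count-reflects f h₁ ,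
  (λ q → not-reflects _ _ (count-reflects (λ q → not-antitone _ _ (g q)) h₂ q))

-- The split is decided by comparing two numbers at one valuation, so it is constructive and needs
-- no decision about equivalence of formulas.
⊑-strict : ∀ {n} {A B : Approx n} → A ⊑ B → B ⊑ A ⊎ precision A < precision B
⊑-strict {A = A} {B} A⊑B with precision B ≤? precision A
... | yes h = inj₁ (precision-reflects A⊑B h)
... | no  h = inj₂ (≰⇒> h)

-- Least fixpoints and refinements at a single valuation

-- F X Y evaluates the rule bodies with positive occurrences of defined atoms
-- read in X and negative ones in Y.
module Alternating {n : ℕ} (F : Assignment n → Assignment n → Assignment n)
  (F-mono : ∀ {X X′ Y Y′} → X ⊆ X′ → Y′ ⊆ Y → F X Y ⊆ F X′ Y′) where

  iterate : Assignment n → ℕ → Assignment n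
  iterate Y zero    = λ _ → false
  iterate Y (suc k) = F (iterate Y k) Y

  lfp : Assignment n → Assignment n
  lfp Y = iterate Y n

  iterate-least : ∀ {X Y} k → F X Y ⊆ X → iterate Y k ⊆ X
  iterate-least zero    p q ()
  iterate-least (suc k) p = ⊆-trans (F-mono (iterate-least k p) (λ _ → id)) p

  iterate-increasing : ∀ Y k → iterate Y k ⊆ iterate Y (suc k)
  iterate-increasing Y zero    q ()
  iterate-increasing Y (suc k) = F-mono (iterate-increasing Y k) (λ _ → id)

  -- As long as the chain grows it gains an atom per step; once a step adds nothing, monotonicity
  -- carries this to all later steps. At `k = n` the first alternative leaves no atom to be gained.
  iterate-progress : ∀ Y k →
    k ≤ count (iterate Y k) ⊎ iterate Y (suc k) ⊆ iterate Y k
  iterate-progress Y zero = inj₁ z≤n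
  iterate-progress Y (suc k) with iterate-progress Y k
  ... | inj₂ p = inj₂ (F-mono p (λ _ → id))
  ... | inj₁ k≤ with count (iterate Y (suc k)) ≤? count (iterate Y k)
  ...   | yes h = inj₂ (F-mono (count-reflects (iterate-increasing Y k) h) (λ _ → id))
  ...   | no  h = inj₁ (≤-trans (s≤s k≤) (≰⇒> h))

  lfp-closed : ∀ Y → F (lfp Y) Y ⊆ lfp Y
  lfp-closed Y with iterate-progress Y n
  ... | inj₂ p  = p
  ... | inj₁ n≤ = count-reflects (iterate-increasing Y n)
                    (≤-trans (count≤n (iterate Y (suc n))) n≤)

  lfp-least : ∀ {X Y} → F X Y ⊆ X → lfp Y ⊆ X
  lfp-least = iterate-least n

  lfp-expands : ∀ Y → lfp Y ⊆ F (lfp Y) Y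
  lfp-expands Y = iterate-increasing Y n

  lfp-antitone : ∀ {Y Y′} → Y ⊆ Y′ → lfp Y′ ⊆ lfp Y
  lfp-antitone h = lfp-least (⊆-trans (F-mono (λ _ → id) h) (lfp-closed _))

  apply! refound! : Approx n → Approx n
  apply!   (X , Y) = F X Y , F Y X
  refound! (X , Y) = X , lfp X

  -- Only the inequalities from above are required. In this form every stable interpretation
  -- qualifies as well, and a pair of this kind bounds all runs; the reverse inequalities hold along
  -- runs because of consistency.
  Done : Approx n → Set
  Done A = apply! A ⊑ A × refound! A ⊑ A

  apply!-mono : ∀ {A B} → A ⊑ B → apply! A ⊑ apply! B
  apply!-mono (f , g) = F-mono f g , F-mono g f

  refound!-mono : ∀ {A B} → A ⊑ B → refound! A ⊑ refound! B
  refound!-mono (f , _) = f , lfp-antitone f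

  -- The hypothesis contains `F Y X ⊆ Y`: the upper bound is a prefixed point of the map whose least
  -- fixpoint replaces it.
  refound!-refines : ∀ {A} → A ⊑ apply! A → A ⊑ refound! A
  refound!-refines (_ , g) = (λ _ → id) , lfp-least g

  refound!-consistent : ∀ {A} → A ⊑ apply! A → refound! A ⊑ apply! (refound! A)
  refound!-consistent p@(f , g) =
    ⊆-trans f (F-mono (λ _ → id) (lfp-least g)) , lfp-closed _

  Done-resp : ∀ {A B} → A ≅ B → Done A → Done B
  Done-resp (A⊑B , B⊑A) (p , r) =
    ⊑-trans (apply!-mono B⊑A) (⊑-trans p A⊑B) ,
    ⊑-trans (refound!-mono B⊑A) (⊑-trans r A⊑B)

-- Correctness of circuit construction

formulaAt-old : ∀ (g : Gate I) c {r} → r < length c → formulaAt (g ∷ c) r ≡ formulaAt c r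
formulaAt-old g c {r} r<c with r ≟ length c
... | no  _    = refl
... | yes refl = ⊥-elim (<-irrefl refl r<c)

gateValue : (I → Bool) → Gates I → Gate I → Bool
gateValue v c (input i) = v i
gateValue v c (const b) = b
gateValue v c (inv r)   = not (eval v (formulaAt c r))
gateValue v c (and r s) = eval v (formulaAt c r) ∧ eval v (formulaAt c s)
gateValue v c (or r s)  = eval v (formulaAt c r) ∨ eval v (formulaAt c s)

eval-formulaAt-new : ∀ v (g : Gate I) c → eval v (formulaAt (g ∷ c) (length c)) ≡ gateValue v c g
eval-formulaAt-new v g c with length c ≟ length c
... | no ¬p = ⊥-elim (¬p refl)
eval-formulaAt-new v (input i)     c | yes _ = refl
eval-formulaAt-new v (const true)  c | yes _ = refl
eval-formulaAt-new v (const false) c | yes _ = refl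
eval-formulaAt-new v (inv r)       c | yes _ = refl
eval-formulaAt-new v (and r s)     c | yes _ = refl
eval-formulaAt-new v (or r s)      c | yes _ = refl

formulaAt-mapG : ∀ (f : I → J) c r → formulaAt (map (mapG f) c) r ≡ mapF f (formulaAt c r)
formulaAt-mapG f []      r = refl
formulaAt-mapG f (g ∷ c) r with r ≟ length (map (mapG f) c) | r ≟ length c
... | no  _ | no  _ = formulaAt-mapG f c r
... | yes p | no ¬p = ⊥-elim (¬p (trans p (length-map (mapG f) c)))
... | no ¬p | yes p = ⊥-elim (¬p (trans p (sym (length-map (mapG f) c))))
formulaAt-mapG f (input i     ∷ c) r | yes _ | yes _ = refl
formulaAt-mapG f (const true  ∷ c) r | yes _ | yes _ = refl
formulaAt-mapG f (const false ∷ c) r | yes _ | yes _ = refl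
formulaAt-mapG f (inv s       ∷ c) r | yes _ | yes _ = cong ∼_ (formulaAt-mapG f c s)
formulaAt-mapG f (and s t     ∷ c) r | yes _ | yes _ =
  cong₂ _⩓_ (formulaAt-mapG f c s) (formulaAt-mapG f c t)
formulaAt-mapG f (or s t      ∷ c) r | yes _ | yes _ =
  cong₂ _⩔_ (formulaAt-mapG f c s) (formulaAt-mapG f c t)

AllWellWired-mapG : ∀ (f : I → J) c → AllWellWired c → AllWellWired (map (mapG f) c)
AllWellWired-mapG f []      _       = tt
AllWellWired-mapG f (g ∷ c) (w , a) = wired-mapG g w , AllWellWired-mapG f c a
  where
  wired-mapG : ∀ g → WellWired (length c) g → WellWired (length (map (mapG f) c)) (mapG f g)
  wired-mapG g w rewrite length-map (mapG f) c with g
  ... | input _ = tt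
  ... | const _ = tt
  ... | inv _   = w
  ... | and _ _ = w
  ... | or _ _  = w

-- Extension of a pool by newer gates, expressed through what later constructions rely on: a name
-- already in use keeps its formula, so circuits built earlier can be reused.
record _≼_ (c c′ : Gates I) : Set where
  field
    length-≤ : length c ≤ length c′
    formulas : ∀ {r} → r < length c → formulaAt c′ r ≡ formulaAt c r

open _≼_

≼-refl : ∀ {c : Gates I} → c ≼ c
≼-refl = record { length-≤ = ≤-refl ; formulas = λ _ → refl }

≼-trans : ∀ {a b c : Gates I} → a ≼ b → b ≼ c → a ≼ c
≼-trans p q = record
  { length-≤ = ≤-trans (length-≤ p) (length-≤ q)
  ; formulas = λ r< → trans (formulas q (≤-trans r< (length-≤ p))) (formulas p r<) }

≼-add : ∀ (g : Gate I) c → c ≼ (g ∷ c)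
≼-add g c = record { length-≤ = n≤1+n _ ; formulas = formulaAt-old g c }

leafValue : (I → Bool) → Gates I → Leaf I → Bool
leafValue v c (wire r) = eval v (formulaAt c r)
leafValue v c (inp i)  = v i

-- A name beyond the pool denotes the dummy `ff` until a new gate takes it. The bound excludes such
-- wires, so leaf values survive extensions.
WiresBelow : ℕ → Formula (Leaf I) → Set
WiresBelow k ff              = ⊤
WiresBelow k tt              = ⊤
WiresBelow k (atom (wire r)) = r < k
WiresBelow k (atom (inp i))  = ⊤
WiresBelow k (∼ φ)           = WiresBelow k φ
WiresBelow k (φ ⩓ ψ)         = WiresBelow k φ × WiresBelow k ψ
WiresBelow k (φ ⩔ ψ)         = WiresBelow k φ × WiresBelow k ψ

WiresBelow-mono : ∀ (φ : Formula (Leaf I)) {k l} → k ≤ l → WiresBelow k φ → WiresBelow l φ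
WiresBelow-mono ff              h w         = tt
WiresBelow-mono tt              h w         = tt
WiresBelow-mono (atom (wire r)) h w         = ≤-trans w h
WiresBelow-mono (atom (inp i))  h w         = tt
WiresBelow-mono (∼ φ)           h w         = WiresBelow-mono φ h w
WiresBelow-mono (φ ⩓ ψ)         h (w₁ , w₂) = WiresBelow-mono φ h w₁ , WiresBelow-mono ψ h w₂
WiresBelow-mono (φ ⩔ ψ)         h (w₁ , w₂) = WiresBelow-mono φ h w₁ , WiresBelow-mono ψ h w₂

eval-≼ : ∀ {c c′ : Gates I} → c ≼ c′ → ∀ φ → WiresBelow (length c) φ → ∀ v →
         eval (leafValue v c′) φ ≡ eval (leafValue v c) φ
eval-≼ e ff              w         v = refl
eval-≼ e tt              w         v = refl
eval-≼ e (atom (wire r)) w         v = cong (eval v) (formulas e w)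
eval-≼ e (atom (inp i))  w         v = refl
eval-≼ e (∼ φ)           w         v = cong not (eval-≼ e φ w v)
eval-≼ e (φ ⩓ ψ)         (w₁ , w₂) v = cong₂ _∧_ (eval-≼ e φ w₁ v) (eval-≼ e ψ w₂ v)
eval-≼ e (φ ⩔ ψ)         (w₁ , w₂) v = cong₂ _∨_ (eval-≼ e φ w₁ v) (eval-≼ e ψ w₂ v)

-- In `computes` the leaves are read in the pool `c` from before the construction. Formulas built
-- one after another thus get specifications over the same pool, although each construction starts
-- from a larger one.
record Builds (c : Gates I) (φ : Formula (Leaf I)) (c′ : Gates I) (r : ℕ) : Set where
  field
    extends  : c ≼ c′
    wellW    : AllWellWired c′
    inRange  : r < length c′
    computes : ∀ v → eval v (formulaAt c′ r) ≡ eval (leafValue v c) φ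

open Builds

builds-gate : ∀ {c c₁ : Gates I} {φ} g → c ≼ c₁ → AllWellWired c₁ → WellWired (length c₁) g →
              (∀ v → gateValue v c₁ g ≡ eval (leafValue v c) φ) →
              Builds c φ (g ∷ c₁) (length c₁)
builds-gate {c₁ = c₁} g e w wg h = record
  { extends  = ≼-trans e (≼-add g c₁)
  ; wellW    = wg , w
  ; inRange  = ≤-refl
  ; computes = λ v → trans (eval-formulaAt-new v g c₁) (h v) }

build-correct : ∀ (φ : Formula (Leaf I)) c → AllWellWired c → WiresBelow (length c) φ →
                Builds c φ (proj₁ (build φ c)) (proj₂ (build φ c))

builds-both : ∀ (φ ψ : Formula (Leaf I)) c → AllWellWired c →
              WiresBelow (length c) φ → WiresBelow (length c) ψ →
              let (c₁ , s) = build ψ c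
                  (c₂ , r) = build φ c₁
              in Builds c φ c₂ r × Builds c ψ c₂ s

build-correct ff c a w = builds-gate (const false) ≼-refl a tt (λ _ → refl)
build-correct tt c a w = builds-gate (const true) ≼-refl a tt (λ _ → refl)
build-correct (atom (wire r)) c a w =
  record { extends = ≼-refl ; wellW = a ; inRange = w ; computes = λ _ → refl }
build-correct (atom (inp i)) c a w = builds-gate (input i) ≼-refl a tt (λ _ → refl)
build-correct (∼ φ) c a w =
  let b = build-correct φ c a w
  in builds-gate (inv _) (extends b) (wellW b) (inRange b) (cong not ∘ computes b)
build-correct (φ ⩓ ψ) c a (w₁ , w₂) =
  let (b , d) = builds-both φ ψ c a w₁ w₂
  in builds-gate (and _ _) (extends b) (wellW b) (inRange b , inRange d)
       (λ v → cong₂ _∧_ (computes b v) (computes d v))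
build-correct (φ ⩔ ψ) c a (w₁ , w₂) =
  let (b , d) = builds-both φ ψ c a w₁ w₂
  in builds-gate (or _ _) (extends b) (wellW b) (inRange b , inRange d)
       (λ v → cong₂ _∨_ (computes b v) (computes d v))

builds-both φ ψ c a w₁ w₂ =
  let d = build-correct ψ c a w₂
      b = build-correct φ _ (wellW d) (WiresBelow-mono φ (length-≤ (extends d)) w₁)
  in record
       { extends  = ≼-trans (extends d) (extends b)
       ; wellW    = wellW b
       ; inRange  = inRange b
       ; computes = λ v → trans (computes b v) (eval-≼ (extends d) φ w₁ v) }
   , record
       { extends  = ≼-trans (extends d) (extends b)
       ; wellW    = wellW b
       ; inRange  = ≤-trans (inRange d) (length-≤ (extends b))
       ; computes = λ v → trans (cong (eval v) (formulas (extends b) (inRange d))) (computes d v) }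

buildAll-correct : ∀ {k} (φ : Fin k → Formula (Leaf I)) c → AllWellWired c →
                   (∀ q → WiresBelow (length c) (φ q)) →
                   let (c′ , rs) = buildAll φ c in
                   (c ≼ c′ × AllWellWired c′) × (∀ q → Builds c (φ q) c′ (lookup rs q))
buildAll-correct {k = zero}  φ c a w = (≼-refl , a) , λ ()
buildAll-correct {k = suc k} φ c a w =
  let ((e , a₁) , bs) = buildAll-correct (φ ∘ Fin.suc) c a (w ∘ Fin.suc)
      b = build-correct (φ Fin.zero) _ a₁ (WiresBelow-mono (φ Fin.zero) (length-≤ e) (w Fin.zero))
      e′ = ≼-trans e (extends b)
  in (e′ , wellW b) , λ where
       Fin.zero → record
         { extends  = e′
         ; wellW    = wellW b
         ; inRange  = inRange b
         ; computes = λ v → trans (computes b v) (eval-≼ e (φ Fin.zero) (w Fin.zero) v) }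
       (Fin.suc q) → record
         { extends  = e′
         ; wellW    = wellW b
         ; inRange  = ≤-trans (inRange (bs q)) (length-≤ (extends b))
         ; computes = λ v → trans (cong (eval v) (formulas (extends b) (inRange (bs q))))
                                  (computes (bs q) v) }

-- The value of φ^𝒮 at a valuation

-- One component of φ^𝒮 at a valuation; exchanging `X` and `Y` gives the other one. Negation
-- exchanges them too, which makes the value monotone in `X` and antitone in `Y`.
signed : ∀ {m n} → (Fin m → Bool) → Assignment n → Assignment n → Formula (Atom m n) → Bool
signed v X Y ff             = false
signed v X Y tt             = true
signed v X Y (atom (par q)) = v q
signed v X Y (atom (def q)) = X q
signed v X Y (∼ φ)          = not (signed v Y X φ)
signed v X Y (φ ⩓ ψ)        = signed v X Y φ ∧ signed v X Y ψ
signed v X Y (φ ⩔ ψ)        = signed v X Y φ ∨ signed v X Y ψ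

module _ {m n : ℕ} {X : Set} (w : X → Bool)
         (p : Fin m → Formula X) (d : Fin n → Formula X × Formula X) where

  eval-substitute₁ : ∀ φ → eval w (proj₁ (substitute p d φ)) ≡
    signed (eval w ∘ p) (eval w ∘ proj₁ ∘ d) (eval w ∘ proj₂ ∘ d) φ
  eval-substitute₂ : ∀ φ → eval w (proj₂ (substitute p d φ)) ≡
    signed (eval w ∘ p) (eval w ∘ proj₂ ∘ d) (eval w ∘ proj₁ ∘ d) φ

  eval-substitute₁ ff             = refl
  eval-substitute₁ tt             = refl
  eval-substitute₁ (atom (par q)) = refl
  eval-substitute₁ (atom (def q)) = refl
  eval-substitute₁ (∼ φ)          = cong not (eval-substitute₂ φ)
  eval-substitute₁ (φ ⩓ ψ)        = cong₂ _∧_ (eval-substitute₁ φ) (eval-substitute₁ ψ)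
  eval-substitute₁ (φ ⩔ ψ)        = cong₂ _∨_ (eval-substitute₁ φ) (eval-substitute₁ ψ)

  eval-substitute₂ ff             = refl
  eval-substitute₂ tt             = refl
  eval-substitute₂ (atom (par q)) = refl
  eval-substitute₂ (atom (def q)) = refl
  eval-substitute₂ (∼ φ)          = cong not (eval-substitute₁ φ)
  eval-substitute₂ (φ ⩓ ψ)        = cong₂ _∧_ (eval-substitute₂ φ) (eval-substitute₂ ψ)
  eval-substitute₂ (φ ⩔ ψ)        = cong₂ _∨_ (eval-substitute₂ φ) (eval-substitute₂ ψ)

∧-mono : ∀ a {a′ b b′} → (T a → T a′) → (T b → T b′) → T (a ∧ b) → T (a′ ∧ b′)
∧-mono true {true}  f g t = g t
∧-mono true {false} f g t = ⊥-elim (f tt)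

∨-mono : ∀ a {a′ b b′} → (T a → T a′) → (T b → T b′) → T (a ∨ b) → T (a′ ∨ b′)
∨-mono a     {true}  f g t = tt
∨-mono false {false} f g t = g t
∨-mono true  {false} f g t = ⊥-elim (f tt)

signed-mono : ∀ {m n} (v : Fin m → Bool) {X X′ Y Y′ : Assignment n} → X ⊆ X′ → Y′ ⊆ Y →
              ∀ φ → T (signed v X Y φ) → T (signed v X′ Y′ φ)
signed-mono v f g tt             t = tt
signed-mono v f g (atom (par q)) t = t
signed-mono v f g (atom (def q)) t = f q t
signed-mono v f g (∼ φ)          t = not-antitone _ _ (signed-mono v g f φ) t
signed-mono v f g (φ ⩓ ψ)        t =
  ∧-mono (signed v _ _ φ) (signed-mono v f g φ) (signed-mono v f g ψ) t
signed-mono v f g (φ ⩔ ψ)        t =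
  ∨-mono (signed v _ _ φ) (signed-mono v f g φ) (signed-mono v f g ψ) t

module _ {m n : ℕ} (k : ℕ) (xs ys : Vec ℕ n)
         (xs< : ∀ q → lookup xs q < k) (ys< : ∀ q → lookup ys q < k) where

  private
    sub : Formula (Atom m n) → Formula (Leaf (Fin m)) × Formula (Leaf (Fin m))
    sub = substitute (atom ∘ inp) (λ r → atom (wire (lookup xs r)) , atom (wire (lookup ys r)))

  substitute-below : ∀ φ → WiresBelow k (proj₁ (sub φ)) × WiresBelow k (proj₂ (sub φ))
  substitute-below ff             = tt , tt
  substitute-below tt             = tt , tt
  substitute-below (atom (par q)) = tt , tt
  substitute-below (atom (def q)) = xs< q , ys< q
  substitute-below (∼ φ)          = swap (substitute-below φ)
  substitute-below (φ ⩓ ψ)        =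
    let (a , b) = substitute-below φ
        (c , d) = substitute-below ψ
    in (a , c) , (b , d)
  substitute-below (φ ⩔ ψ)        =
    let (a , b) = substitute-below φ
        (c , d) = substitute-below ψ
    in (a , c) , (b , d)

-- Runs at a valuation

infix 4 _≐_

_≐_ : ∀ {n} → Assignment n → Assignment n → Set
X ≐ Y = X ⊆ Y × Y ⊆ X

≗⇒≐ : ∀ {n} {X Y : Assignment n} → X ≗ Y → X ≐ Y
≗⇒≐ e = ≗⇒⊆ e , ≗⇒⊇ e

≐-sym : ∀ {n} {X Y : Assignment n} → X ≐ Y → Y ≐ X
≐-sym = swap

≐-trans : ∀ {n} {X Y Z : Assignment n} → X ≐ Y → Y ≐ Z → X ≐ Z
≐-trans (f , g) (f′ , g′) = ⊆-trans f f′ , ⊆-trans g′ g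

at : ∀ {m n} → (Fin m → Bool) → Symbolic m n → Assignment n
at v x q = eval v (x q)

atₚ : ∀ {m n} → (Fin m → Bool) → Partial m n → Approx n
atₚ v (x , y) = at v x , at v y

≤ₚ⇒⊑ : ∀ {m n} (S S′ : Partial m n) → S ≤ₚ S′ → ∀ v → atₚ v S ⊑ atₚ v S′
≤ₚ⇒⊑ S S′ (f , g) v = (λ q → f q v) , (λ q → g q v)

⊑⇒≤ₚ : ∀ {m n} (S S′ : Partial m n) → (∀ v → atₚ v S ⊑ atₚ v S′) → S ≤ₚ S′
⊑⇒≤ₚ S S′ h = (λ q v → proj₁ (h v) q) , (λ q v → proj₂ (h v) q)

≈ₚ⇒≅ : ∀ {m n} (S S′ : Partial m n) → S ≈ₚ S′ → ∀ v → atₚ v S ≅ atₚ v S′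
≈ₚ⇒≅ S S′ (f , g) v = ((λ q → proj₁ (f q) v) , (λ q → proj₂ (g q) v))
               , ((λ q → proj₂ (f q) v) , (λ q → proj₁ (g q) v))

≅⇒≈ₚ : ∀ {m n} (S S′ : Partial m n) → (∀ v → atₚ v S ≅ atₚ v S′) → S ≈ₚ S′
≅⇒≈ₚ S S′ h = (λ q → (λ v → proj₁ (proj₁ (h v)) q) , (λ v → proj₁ (proj₂ (h v)) q))
       , (λ q → (λ v → proj₂ (proj₂ (h v)) q) , (λ v → proj₂ (proj₁ (h v)) q))

≈ˢ⇒≐ : ∀ {m n} (x y : Symbolic m n) → x ≈ˢ y → ∀ v → at v x ≐ at v y
≈ˢ⇒≐ x y h v = (λ q → proj₁ (h q) v) , (λ q → proj₂ (h q) v)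

≐⇒≈ˢ : ∀ {m n} (x y : Symbolic m n) → (∀ v → at v x ≐ at v y) → x ≈ˢ y
≐⇒≈ˢ x y h q = (λ v → proj₁ (h v) q) , (λ v → proj₂ (h v) q)

record Valid {m n} (S : State m n) : Set where
  field
    pool-wired : AllWellWired (pool S)
    𝔖ₜ<        : ∀ q → lookup (𝔖ₜ S) q < length (pool S)
    𝔖ₚ<        : ∀ q → lookup (𝔖ₚ S) q < length (pool S)

open Valid

initial-valid : ∀ {m n} → Valid (initial {m} {n})
initial-valid = record
  { pool-wired = tt , tt , tt
  ; 𝔖ₜ< = λ q → subst (_< 2) (sym (lookup-replicate q 0)) (s≤s z≤n)
  ; 𝔖ₚ< = λ q → subst (_< 2) (sym (lookup-replicate q 1)) (s≤s (s≤s z≤n)) }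

-- Symbolic states and runs, compared with their values at valuations

module Semantics {m n : ℕ} (P : Program m n) where

  F : (Fin m → Bool) → Assignment n → Assignment n → Assignment n
  F v X Y q = signed v X Y (φ[ P ] q)

  F-mono : ∀ v {X X′ Y Y′} → X ⊆ X′ → Y′ ⊆ Y → F v X Y ⊆ F v X′ Y′
  F-mono v f g q = signed-mono v f g (φ[ P ] q)

  open module Alt v = Alternating (F v) (F-mono v) public

  F-resp : ∀ v {X X′ Y Y′} → X ≐ X′ → Y ≐ Y′ → F v X Y ≐ F v X′ Y′
  F-resp v (f , f′) (g , g′) = F-mono v f g′ , F-mono v f′ g

  Ψ₁-at : ∀ v x y → at v (proj₁ (Ψ P (x , y))) ≗ F v (at v x) (at v y)
  Ψ₁-at v x y q = eval-substitute₁ v atom (λ r → x r , y r) (φ[ P ] q)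

  Ψ₂-at : ∀ v x y → at v (proj₂ (Ψ P (x , y))) ≗ F v (at v y) (at v x)
  Ψ₂-at v x y q = eval-substitute₂ v atom (λ r → x r , y r) (φ[ P ] q)

  Ψ-at : ∀ v S → atₚ v (Ψ P S) ≅ apply! v (atₚ v S)
  Ψ-at v (x , y) = (≗⇒⊆ (Ψ₁-at v x y) , ≗⇒⊇ (Ψ₂-at v x y))
                 , (≗⇒⊇ (Ψ₁-at v x y) , ≗⇒⊆ (Ψ₂-at v x y))

  module _ (f : Symbolic m n → Symbolic m n) (w : Symbolic m n)
           (f-at : ∀ v z → at v (f z) ≗ F v (at v z) (at v w)) where

    power : ℕ → Symbolic m n
    power zero    = λ _ → ff
    power (suc k) = f (power k)

    power-at : ∀ v k → at v (power k) ≐ iterate v (at v w) k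
    power-at v zero    = (λ _ → id) , (λ _ → id)
    power-at v (suc k) =
      ≐-trans (≗⇒≐ (f-at v (power k))) (F-resp v (power-at v k) ((λ _ → id) , (λ _ → id)))

    -- `IsLfp` compares `x` with symbolic fixpoints only, so a single formula per atom is needed
    -- that takes the value of the pointwise least fixpoint at all valuations simultaneously. The
    -- `n`-th power of `f` is such a fixpoint, as `n` iterations suffice at every valuation.
    IsLfp⇒lfp : ∀ x → IsLfp f x → ∀ v → at v x ≐ lfp v (at v w)
    IsLfp⇒lfp x (fixed , least) v =
      ⊆-trans (λ q → least (power n) power-fixed q v) (proj₁ (power-at v n)) ,
      lfp-least v (⊆-trans (≗⇒⊇ (f-at v x)) (proj₁ (≈ˢ⇒≐ (f x) x fixed v)))
      where
      power-fixed : f (power n) ≈ˢ power n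
      power-fixed = ≐⇒≈ˢ (f (power n)) (power n) λ u →
        ≐-trans (power-at u (suc n))
          (≐-trans (lfp-closed u (at u w) , lfp-expands u (at u w)) (≐-sym (power-at u n)))

    lfp⇒IsLfp : ∀ x → (∀ v → at v x ≐ lfp v (at v w)) → IsLfp f x
    lfp⇒IsLfp x h =
      ≐⇒≈ˢ (f x) x (λ v → ≐-trans (≗⇒≐ (f-at v x))
        (≐-trans (F-resp v (h v) ((λ _ → id) , (λ _ → id)))
          (≐-trans (lfp-closed v (at v w) , lfp-expands v (at v w)) (≐-sym (h v))))) ,
      λ z fz≈z q v t →
        lfp-least v (⊆-trans (≗⇒⊇ (f-at v z)) (proj₁ (≈ˢ⇒≐ (f z) z fz≈z v))) q
          (proj₁ (h v) q t)

  Ψ₁[_] Ψ₂[_] : Symbolic m n → Symbolic m n → Symbolic m n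
  Ψ₁[ y ] x = proj₁ (Ψ P (x , y))
  Ψ₂[ x ] y = proj₂ (Ψ P (x , y))

  lfp⇒IsLfp₁ : ∀ x y → (∀ v → at v x ≐ lfp v (at v y)) → IsLfp Ψ₁[ y ] x
  lfp⇒IsLfp₁ x y = lfp⇒IsLfp Ψ₁[ y ] y (λ v z → Ψ₁-at v z y) x

  lfp⇒IsLfp₂ : ∀ x y → (∀ v → at v y ≐ lfp v (at v x)) → IsLfp Ψ₂[ x ] y
  lfp⇒IsLfp₂ x y = lfp⇒IsLfp Ψ₂[ x ] x (λ v z → Ψ₂-at v x z) y

  IsLfp₂⇒lfp : ∀ x y → IsLfp Ψ₂[ x ] y → ∀ v → at v y ≐ lfp v (at v x)
  IsLfp₂⇒lfp x y = IsLfp⇒lfp Ψ₂[ x ] x (λ v z → Ψ₂-at v x z) y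

  application-at : ∀ {S S′} → Application P S S′ → ∀ v →
                   atₚ v ⟦ S′ ⟧ ≅ apply! v (atₚ v ⟦ S ⟧)
  application-at {S} {S′} app v =
    let (a , b) = ≈ₚ⇒≅ ⟦ S′ ⟧ (Ψ P ⟦ S ⟧) (Application.represents app) v
        (c , d) = Ψ-at v ⟦ S ⟧
    in ⊑-trans a c , ⊑-trans d b

  application-⊑ : ∀ {S S′} → Application P S S′ → ∀ v → atₚ v ⟦ S ⟧ ⊑ atₚ v ⟦ S′ ⟧
  application-⊑ {S} {S′} app = ≤ₚ⇒⊑ ⟦ S ⟧ ⟦ S′ ⟧ (Application.refines app)

  -- The number of iterations in an unfoundedness refinement is free, but `founded` pins the upper
  -- bound to the least fixpoint at every valuation.
  unfoundedness-at : ∀ {S S′} → Unfoundedness P S S′ → ∀ v →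
                     atₚ v ⟦ S′ ⟧ ≅ refound! v (atₚ v ⟦ S ⟧)
  unfoundedness-at {S} {S′} u v =
    let (a , b) = ≈ˢ⇒≐ (proj₁ ⟦ S′ ⟧) (proj₁ ⟦ S ⟧) (Unfoundedness.unchanged u) v
        (c , d) = IsLfp₂⇒lfp (proj₁ ⟦ S ⟧) (proj₂ ⟦ S′ ⟧) (Unfoundedness.founded u) v
    in (a , d) , (b , c)

  unfoundedness-⊑ : ∀ {S S′} → Unfoundedness P S S′ → ∀ v → atₚ v ⟦ S ⟧ ⊑ atₚ v ⟦ S′ ⟧
  unfoundedness-⊑ {S} {S′} u = ≤ₚ⇒⊑ ⟦ S ⟧ ⟦ S′ ⟧ (Unfoundedness.refines u)

  private
    wired-below : ∀ k xs ys → (∀ q → lookup xs q < k) → (∀ q → lookup ys q < k) → ∀ q →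
                  WiresBelow k (proj₁ (wired P xs ys q)) × WiresBelow k (proj₂ (wired P xs ys q))
    wired-below k xs ys xs< ys< q = substitute-below k xs ys xs< ys< (φ[ P ] q)

  wired₁-at : ∀ v c xs ys q → eval (leafValue v c) (proj₁ (wired P xs ys q)) ≡
    F v (eval v ∘ formulaAt c ∘ lookup xs) (eval v ∘ formulaAt c ∘ lookup ys) q
  wired₁-at v c xs ys q = eval-substitute₁ (leafValue v c) (atom ∘ inp) _ (φ[ P ] q)

  wired₂-at : ∀ v c xs ys q → eval (leafValue v c) (proj₂ (wired P xs ys q)) ≡
    F v (eval v ∘ formulaAt c ∘ lookup ys) (eval v ∘ formulaAt c ∘ lookup xs) q
  wired₂-at v c xs ys q = eval-substitute₂ (leafValue v c) (atom ∘ inp) _ (φ[ P ] q)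

  applied-correct : ∀ S → Valid S →
    Valid (applied P S) × (∀ v → atₚ v ⟦ applied P S ⟧ ≅ apply! v (atₚ v ⟦ S ⟧))
  applied-correct S@(state c xs ys) val =
    record
      { pool-wired = a₂
      ; 𝔖ₜ< = λ q → ≤-trans (inRange (bs₁ q)) (length-≤ e₂)
      ; 𝔖ₚ< = λ q → inRange (bs₂ q) } ,
    λ v → (≗⇒⊆ (lower v) , ≗⇒⊇ (upper v)) , (≗⇒⊇ (lower v) , ≗⇒⊆ (upper v))
    where
    below = wired-below (length c) xs ys (𝔖ₜ< val) (𝔖ₚ< val)
    first = buildAll-correct (proj₁ ∘ wired P xs ys) c (pool-wired val) (proj₁ ∘ below)
    e₁ = proj₁ (proj₁ first)
    bs₁ = proj₂ first
    second = buildAll-correct (proj₂ ∘ wired P xs ys) _ (proj₂ (proj₁ first))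
               (λ q → WiresBelow-mono (proj₂ (wired P xs ys q)) (length-≤ e₁) (proj₂ (below q)))
    e₂ = proj₁ (proj₁ second)
    a₂ = proj₂ (proj₁ second)
    bs₂ = proj₂ second
    lower : ∀ v → at v (proj₁ ⟦ applied P S ⟧) ≗ F v (at v (proj₁ ⟦ S ⟧)) (at v (proj₂ ⟦ S ⟧))
    lower v q = trans (cong (eval v) (formulas e₂ (inRange (bs₁ q))))
                  (trans (computes (bs₁ q) v) (wired₁-at v c xs ys q))
    upper : ∀ v → at v (proj₂ ⟦ applied P S ⟧) ≗ F v (at v (proj₂ ⟦ S ⟧)) (at v (proj₁ ⟦ S ⟧))
    upper v q = trans (computes (bs₂ q) v)
                  (trans (eval-≼ e₁ (proj₂ (wired P xs ys q)) (proj₂ (below q)) v)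
                    (wired₂-at v c xs ys q))

  iterated-correct : ∀ xs c → AllWellWired c → (∀ q → lookup xs q < length c) → ∀ k →
    let (c′ , ys) = iterated P xs k c in
    (c ≼ c′ × AllWellWired c′) × (∀ q → lookup ys q < length c′) ×
    (∀ v → (eval v ∘ formulaAt c′ ∘ lookup ys) ≐ iterate v (eval v ∘ formulaAt c ∘ lookup xs) k)
  iterated-correct xs c a xs< zero =
    (≼-add _ c , tt , a) ,
    (λ q → subst (_< suc (length c)) (sym (lookup-replicate q (length c))) ≤-refl) ,
    λ v → ≗⇒≐ λ q → trans (cong (λ r → eval v (formulaAt (const false ∷ c) r)) (lookup-replicate q (length c)))
                          (eval-formulaAt-new v (const false) c)
  iterated-correct xs c a xs< (suc k) =
    let ((e , a₁) , ys< , h) = iterated-correct xs c a xs< k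
        (c₁ , ys) = iterated P xs k c
        ((e′ , a₂) , bs) = buildAll-correct (proj₂ ∘ wired P xs ys) c₁ a₁
          (λ q → proj₂ (wired-below (length c₁) xs ys (λ q → ≤-trans (xs< q) (length-≤ e)) ys< q))
    in (≼-trans e e′ , a₂) , (λ q → inRange (bs q)) ,
       λ v → ≐-trans (≗⇒≐ λ q → trans (computes (bs q) v) (wired₂-at v c₁ xs ys q))
               (F-resp v (h v) (≗⇒≐ λ q → cong (eval v) (formulas e (xs< q))))

  refounded-correct : ∀ S → Valid S → ∀ k →
    Valid (refounded P S k) ×
    (∀ v → at v (proj₁ ⟦ refounded P S k ⟧) ≐ at v (proj₁ ⟦ S ⟧)) ×
    (∀ v → at v (proj₂ ⟦ refounded P S k ⟧) ≐ iterate v (at v (proj₁ ⟦ S ⟧)) k)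
  refounded-correct (state c xs ys) val k =
    let ((e , a) , ys< , h) = iterated-correct xs c (pool-wired val) (𝔖ₜ< val) k
    in record { pool-wired = a ; 𝔖ₜ< = λ q → ≤-trans (𝔖ₜ< val q) (length-≤ e) ; 𝔖ₚ< = ys< } ,
       (λ v → ≗⇒≐ λ q → cong (eval v) (formulas e (𝔖ₜ< val q))) , h

  run-valid : ∀ {S} → Run P S → Valid S
  run-valid start = initial-valid
  run-valid (apply ρ app) rewrite Application.constructed app =
    proj₁ (applied-correct _ (run-valid ρ))
  run-valid (refound ρ _ u) rewrite Unfoundedness.constructed u =
    proj₁ (refounded-correct _ (run-valid ρ) (iterations u))

  initial-least : ∀ v A → atₚ v ⟦ initial {m} {n} ⟧ ⊑ A
  initial-least v A =
    -- Name 0 is the gate `const false` and name 1 the gate `const true`.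
    (λ q t → ⊥-elim (subst value (lookup-replicate q 0) t)) ,
    (λ q _ → subst value (sym (lookup-replicate q 1)) tt)
    where
    value : ℕ → Set
    value r = T (eval v (formulaAt (pool (initial {m} {n})) r))

  -- Both kinds of transition demand that they refine; the invariant guarantees this for `applied`
  -- and `refounded` at every reachable state. An application preserves it because `apply!` is
  -- monotone.
  consistent : ∀ {S} → Run P S → ∀ v → atₚ v ⟦ S ⟧ ⊑ apply! v (atₚ v ⟦ S ⟧)
  consistent start v = initial-least v _
  consistent (apply ρ app) v =
    let (a , b) = application-at app v
    in ⊑-trans a (⊑-trans (apply!-mono v (consistent ρ v)) (apply!-mono v b))
  consistent (refound ρ _ u) v =
    let (a , b) = unfoundedness-at u v
    in ⊑-trans a (⊑-trans (refound!-consistent v (consistent ρ v)) (apply!-mono v b))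

  applied-application : ∀ {S} → Run P S → Application P S (applied P S)
  applied-application {S} ρ = record
    { constructed = refl
    ; represents  = ≅⇒≈ₚ ⟦ applied P S ⟧ (Ψ P ⟦ S ⟧) λ v →
        let (a , b) = h v
            (c , d) = Ψ-at v ⟦ S ⟧
        in ⊑-trans a d , ⊑-trans c b
    ; refines     = ⊑⇒≤ₚ ⟦ S ⟧ ⟦ applied P S ⟧ λ v → ⊑-trans (consistent ρ v) (proj₂ (h v)) }
    where h = proj₂ (applied-correct S (run-valid ρ))

  refounded-founded : ∀ {S} → Run P S → Founded P S (refounded P S n)
  refounded-founded {S} ρ =
    lfp⇒IsLfp₂ (proj₁ ⟦ S ⟧) (proj₂ ⟦ refounded P S n ⟧)
      (proj₂ (proj₂ (refounded-correct S (run-valid ρ) n)))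

  refounded-unfoundedness : ∀ {S} → Run P S → Unfoundedness P S (refounded P S n)
  refounded-unfoundedness {S} ρ = record
    { iterations  = n
    ; constructed = refl
    ; unchanged   = ≐⇒≈ˢ (proj₁ ⟦ refounded P S n ⟧) (proj₁ ⟦ S ⟧) lower
    ; founded     = refounded-founded ρ
    ; refines     = ⊑⇒≤ₚ ⟦ S ⟧ ⟦ refounded P S n ⟧ λ v → proj₂ (lower v) ,
        ⊆-trans (proj₁ (upper v)) (proj₂ (refound!-refines v (consistent ρ v))) }
    where
    lower = proj₁ (proj₂ (refounded-correct S (run-valid ρ) n))
    upper = proj₂ (proj₂ (refounded-correct S (run-valid ρ) n))

  application-not-strict : ∀ {S S′} → Application P S S′ →
    (∀ v → apply! v (atₚ v ⟦ S ⟧) ⊑ atₚ v ⟦ S ⟧) → ⟦ S ⟧ ≈ₚ ⟦ S′ ⟧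
  application-not-strict {S} {S′} app h = ≅⇒≈ₚ ⟦ S ⟧ ⟦ S′ ⟧ λ v →
    application-⊑ app v , ⊑-trans (proj₁ (application-at app v)) (h v)

  unfoundedness-not-strict : ∀ {S S′} → Unfoundedness P S S′ →
    (∀ v → refound! v (atₚ v ⟦ S ⟧) ⊑ atₚ v ⟦ S ⟧) → ⟦ S ⟧ ≈ₚ ⟦ S′ ⟧
  unfoundedness-not-strict {S} {S′} u h = ≅⇒≈ₚ ⟦ S ⟧ ⟦ S′ ⟧ λ v →
    unfoundedness-⊑ u v , ⊑-trans (proj₁ (unfoundedness-at u v)) (h v)

  -- If `applied P S` moved the valuation `v`, it would be a strict refinement of the whole state.
  -- This refutes instability at `v`, and `⊑-stable` does the rest.
  noStrictApplication⇒stable : ∀ {S} → Run P S → NoStrictApplication P S →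
                               ∀ v → apply! v (atₚ v ⟦ S ⟧) ⊑ atₚ v ⟦ S ⟧
  noStrictApplication⇒stable {S} ρ noApp v = ⊑-stable λ ¬stable →
    noApp _ app (Application.refines app , λ S≈ →
      ¬stable (⊑-trans (proj₂ (application-at app v))
                       (proj₂ (≈ₚ⇒≅ ⟦ S ⟧ ⟦ applied P S ⟧ S≈ v))))
    where app = applied-application ρ

  -- How many refinements settle every valuation

  -- `applies` restarts at each unfoundedness refinement, since that can make further applications
  -- effective; `rounds` accumulates, since a valuation in `Done` never leaves it.
  applies rounds : ∀ {S} → Run P S → ℕ
  applies start           = 0
  applies (apply ρ _)     = suc (applies ρ)
  applies (refound ρ _ _) = 0
  rounds start           = 0
  rounds (apply ρ _)     = rounds ρ
  rounds (refound ρ _ _) = suc (rounds ρ)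

  -- A valuation that one application leaves unchanged is left unchanged by all
  -- further ones, so that the others gain precision in every application.
  applies-progress : ∀ {S} (ρ : Run P S) v →
    applies ρ ≤ precision (atₚ v ⟦ S ⟧) ⊎ apply! v (atₚ v ⟦ S ⟧) ⊑ atₚ v ⟦ S ⟧
  applies-progress start v = inj₁ z≤n
  applies-progress (refound ρ _ _) v = inj₁ z≤n
  applies-progress (apply ρ app) v with ⊑-strict (application-⊑ app v)
  ... | inj₁ back = inj₂ (⊑-trans (apply!-mono v back) (proj₂ (application-at app v)))
  ... | inj₂ more with applies-progress ρ v
  ...   | inj₁ p = inj₁ (≤-trans (s≤s p) more)
  ...   | inj₂ s = inj₂ (⊑-trans (apply!-mono v (⊑-trans (proj₁ (application-at app v)) s))
                                 (proj₂ (application-at app v)))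

  Done-preserved-apply : ∀ {S S′} → Application P S S′ → ∀ v →
                         Done v (atₚ v ⟦ S ⟧) → Done v (atₚ v ⟦ S′ ⟧)
  Done-preserved-apply app v d = Done-resp v
    (application-⊑ app v , ⊑-trans (proj₁ (application-at app v)) (proj₁ d)) d

  Done-preserved-refound : ∀ {S S′} → Unfoundedness P S S′ → ∀ v →
                           Done v (atₚ v ⟦ S ⟧) → Done v (atₚ v ⟦ S′ ⟧)
  Done-preserved-refound u v d = Done-resp v
    (unfoundedness-⊑ u v , ⊑-trans (proj₁ (unfoundedness-at u v)) (proj₂ d)) d

  -- Unfoundedness refinements act on application-stable states only, so one that
  -- leaves a valuation unchanged shows that it is settled.
  rounds-progress : ∀ {S} (ρ : Run P S) v →
    rounds ρ ≤ precision (atₚ v ⟦ S ⟧) ⊎ Done v (atₚ v ⟦ S ⟧)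
  rounds-progress start v = inj₁ z≤n
  rounds-progress (apply ρ app) v with rounds-progress ρ v
  ... | inj₁ p = inj₁ (≤-trans p (precision-mono (application-⊑ app v)))
  ... | inj₂ d = inj₂ (Done-preserved-apply app v d)
  rounds-progress (refound ρ noApp u) v with rounds-progress ρ v
  ... | inj₂ d = inj₂ (Done-preserved-refound u v d)
  ... | inj₁ p with ⊑-strict (unfoundedness-⊑ u v)
  ...   | inj₂ more = inj₁ (≤-trans (s≤s p) more)
  ...   | inj₁ back = inj₂ (Done-resp v (unfoundedness-⊑ u v , back)
          (noStrictApplication⇒stable ρ noApp v , ⊑-trans (proj₂ (unfoundedness-at u v)) back))

  -- Without stability the precision would already be the maximum `n + n`; by consistency an
  -- application can only raise it, so it changes nothing.
  enough-applies : ∀ {S} (ρ : Run P S) → n + n ≤ applies ρ →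
                   ∀ v → apply! v (atₚ v ⟦ S ⟧) ⊑ atₚ v ⟦ S ⟧
  enough-applies ρ h v with applies-progress ρ v
  ... | inj₂ s = s
  ... | inj₁ p = precision-reflects (consistent ρ v)
                   (≤-trans (precision≤n+n {n} _) (≤-trans h p))

  enough-rounds : ∀ {S} (ρ : Run P S) → n + n ≤ rounds ρ → ∀ v → Done v (atₚ v ⟦ S ⟧)
  enough-rounds ρ h v with rounds-progress ρ v
  ... | inj₂ d = d
  ... | inj₁ p =
    precision-reflects (consistent ρ v) (≤-trans (precision≤n+n {n} _) (≤-trans h p)) ,
    precision-reflects (refound!-refines v (consistent ρ v)) (≤-trans (precision≤n+n {n} _) (≤-trans h p))

  -- The settled state is the parametrised well-founded model

  -- `Done` makes the final lower bound closed under the rules, but that it is the least such set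
  -- must come from the history of the run. The induction works for arbitrary `Y` because upper
  -- bounds only shrink along a run: a `Y` below the last one is below all earlier ones.
  lower-least : ∀ {S} → Run P S → ∀ v {X Y} → Y ⊆ at v (proj₂ ⟦ S ⟧) → F v X Y ⊆ X →
                at v (proj₁ ⟦ S ⟧) ⊆ X
  lower-least start v {X} {Y} Y⊆ closed = proj₁ (initial-least v (X , Y))
  lower-least (apply ρ app) v Y⊆ closed =
    let Y⊆′ = ⊆-trans Y⊆ (proj₂ (application-⊑ app v))
    in ⊆-trans (proj₁ (proj₁ (application-at app v)))
         (⊆-trans (F-mono v (lower-least ρ v Y⊆′ closed) Y⊆′) closed)
  lower-least (refound ρ _ u) v Y⊆ closed =
    let Y⊆′ = ⊆-trans Y⊆ (proj₂ (unfoundedness-⊑ u v))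
    in ⊆-trans (proj₁ (proj₁ (unfoundedness-at u v))) (lower-least ρ v Y⊆′ closed)

  -- A pair in `Done` is a prefixed point of both monotone operators, and a run starts at the
  -- bottom.
  run-below : ∀ {S} → Run P S → ∀ v {A} → Done v A → atₚ v ⟦ S ⟧ ⊑ A
  run-below start           v d = initial-least v _
  run-below (apply ρ app)   v d = ⊑-trans (proj₁ (application-at app v))
    (⊑-trans (apply!-mono v (run-below ρ v d)) (proj₁ d))
  run-below (refound ρ _ u) v d = ⊑-trans (proj₁ (unfoundedness-at u v))
    (⊑-trans (refound!-mono v (run-below ρ v d)) (proj₂ d))

  Done⇒model : ∀ {S} → Run P S → (∀ v → Done v (atₚ v ⟦ S ⟧)) → IsWellFoundedModel P ⟦ S ⟧
  Done⇒model {S} ρ done =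
    ( lfp⇒IsLfp₁ x y (λ v →
        lower-least ρ v (λ _ → id) (lfp-closed v (at v y)) ,
        lfp-least v (proj₁ (proj₁ (done v))))
    , lfp⇒IsLfp₂ x y (λ v →
        proj₂ (proj₂ (done v)) , lfp-least v (proj₂ (consistent ρ v))) ) ,
    λ S′ stable → ⊑⇒≤ₚ ⟦ S ⟧ S′ λ v → run-below ρ v (stable⇒Done S′ stable v)
    where
    x = proj₁ ⟦ S ⟧
    y = proj₂ ⟦ S ⟧
    stable⇒Done : ∀ S′ → IsStable P S′ → ∀ v → Done v (atₚ v S′)
    stable⇒Done (x′ , y′) (lx , ly) v =
      ( ⊆-trans (≗⇒⊇ (Ψ₁-at v x′ y′)) (proj₁ (≈ˢ⇒≐ (Ψ₁[ y′ ] x′) x′ (proj₁ lx) v))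
      , ⊆-trans (proj₂ (≈ˢ⇒≐ (Ψ₂[ x′ ] y′) y′ (proj₁ ly) v)) (≗⇒⊆ (Ψ₂-at v x′ y′)) ) ,
      ( (λ _ → id) , proj₁ (IsLfp₂⇒lfp x′ y′ ly v) )

-- Sizes of circuits

gatesSize : Gates I → ℕ
gatesSize c = sizeC (circuit c 0)

-- The weights are those of `gateSize`. A wire is charged like an input although `build` adds no
-- gate for it, so the measure is blind to which leaf stands where.
formulaSize : ∀ {A : Set} → Formula A → ℕ
formulaSize ff       = 1
formulaSize tt       = 1
formulaSize (atom _) = 1
formulaSize (∼ φ)    = 2 + formulaSize φ
formulaSize (φ ⩓ ψ)  = 3 + (formulaSize φ + formulaSize ψ)
formulaSize (φ ⩔ ψ)  = 3 + (formulaSize φ + formulaSize ψ)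

build-size : ∀ (φ : Formula (Leaf I)) c →
             gatesSize (proj₁ (build φ c)) ≤ formulaSize φ + gatesSize c
build₂-size : ∀ (φ ψ : Formula (Leaf I)) c →
              gatesSize (proj₁ (build φ (proj₁ (build ψ c)))) ≤
              formulaSize φ + formulaSize ψ + gatesSize c

build-size ff              c = ≤-refl
build-size tt              c = ≤-refl
build-size (atom (wire r)) c = n≤1+n _
build-size (atom (inp i))  c = ≤-refl
build-size (∼ φ)           c = s≤s (s≤s (build-size φ c))
build-size (φ ⩓ ψ)         c = s≤s (s≤s (s≤s (build₂-size φ ψ c)))
build-size (φ ⩔ ψ)         c = s≤s (s≤s (s≤s (build₂-size φ ψ c)))

build₂-size φ ψ c = begin
  gatesSize (proj₁ (build φ (proj₁ (build ψ c))))    ≤⟨ build-size φ _ ⟩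
  formulaSize φ + gatesSize (proj₁ (build ψ c))      ≤⟨ +-monoʳ-≤ (formulaSize φ) (build-size ψ c) ⟩
  formulaSize φ + (formulaSize ψ + gatesSize c)      ≡⟨ +-assoc (formulaSize φ) _ _ ⟨
  formulaSize φ + formulaSize ψ + gatesSize c        ∎
  where open ≤-Reasoning

buildAll-size : ∀ {k b} (φ : Fin k → Formula (Leaf I)) c → (∀ q → formulaSize (φ q) ≤ b) →
                gatesSize (proj₁ (buildAll φ c)) ≤ k * b + gatesSize c
buildAll-size {k = zero}          φ c h = ≤-refl
buildAll-size {k = suc k} {b = b} φ c h = begin
  gatesSize (proj₁ (build (φ Fin.zero) (proj₁ (buildAll (φ ∘ Fin.suc) c))))
    ≤⟨ build-size (φ Fin.zero) _ ⟩
  formulaSize (φ Fin.zero) + gatesSize (proj₁ (buildAll (φ ∘ Fin.suc) c))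
    ≤⟨ +-mono-≤ (h Fin.zero) (buildAll-size (φ ∘ Fin.suc) c (h ∘ Fin.suc)) ⟩
  b + (k * b + gatesSize c)
    ≡⟨ +-assoc b (k * b) _ ⟨
  b + k * b + gatesSize c ∎
  where open ≤-Reasoning

litF-size : ∀ {m n} (l : Literal m n) → formulaSize (litF l) ≤ 3
litF-size (pos a) = s≤s z≤n
litF-size (neg a) = ≤-refl

⋀-size : ∀ {A B : Set} {b} (f : B → Formula A) → (∀ x → formulaSize (f x) ≤ b) → ∀ xs →
         formulaSize (⋀ (map f xs)) ≤ 1 + length xs * (3 + b)
⋀-size         f h []       = ≤-refl
⋀-size {b = b} f h (x ∷ xs) = begin
  3 + (formulaSize (f x) + formulaSize (⋀ (map f xs)))
    ≤⟨ +-monoʳ-≤ 3 (+-mono-≤ (h x) (⋀-size f h xs)) ⟩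
  3 + (b + (1 + length xs * (3 + b)))
    ≡⟨ cong (3 +_) (+-suc b _) ⟩
  4 + (b + length xs * (3 + b)) ∎
  where open ≤-Reasoning

rulesSize : ∀ {m n} → Program m n → ℕ
rulesSize []      = 0
rulesSize (r ∷ P) = suc (length (body r)) + rulesSize P

sizeP≡ : ∀ {m n} (P : Program m n) → sizeP P ≡ m + n + rulesSize P
sizeP≡ {m} {n} P = cong (m + n +_) (go P)
  where
  go : ∀ Q → List.foldr _+_ 0 (map (λ r → suc (length (body r))) Q) ≡ rulesSize Q
  go []      = refl
  go (r ∷ Q) = cong (suc (length (body r)) +_) (go Q)

-- A literal costs at most 6: 3 for its conjunction gate and 3 for a negated leaf.
φ-size : ∀ {m n} (P : Program m n) q → formulaSize (φ[ P ] q) ≤ 1 + rulesSize P * 6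
φ-size []      q = ≤-refl
φ-size (r ∷ P) q with head r Fin.≟ q
... | no  _ = ≤-trans (φ-size P q) (s≤s (*-monoˡ-≤ 6 (m≤n+m (rulesSize P) (suc (length (body r))))))
... | yes _ = begin
  3 + (formulaSize (⋀ (map litF (body r))) + formulaSize (φ[ P ] q))
    ≤⟨ +-monoʳ-≤ 3 (+-mono-≤ (⋀-size litF litF-size (body r)) (φ-size P q)) ⟩
  3 + (1 + l * 6 + (1 + rulesSize P * 6))
    ≡⟨ cong (3 +_) (+-suc (1 + l * 6) _) ⟩
  5 + (l * 6 + rulesSize P * 6)
    -- A selected rule needs 4 besides its literals, for its disjunction gate and the constant
    -- ending its body; `suc l` allots 6.
    ≤⟨ +-monoˡ-≤ _ (m≤m+n 5 2) ⟩
  7 + (l * 6 + rulesSize P * 6)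
    ≡⟨ cong (7 +_) (*-distribʳ-+ 6 l (rulesSize P)) ⟨
  1 + (suc l + rulesSize P) * 6 ∎
  where
  open ≤-Reasoning
  l = length (body r)

-- Every atom is replaced by one leaf, so the size of a layer depends on the program and never on
-- the circuits below it. Circuits therefore grow additively, where substituting formulas for atoms
-- could multiply sizes at every step.
substitute-size : ∀ {m n} {X : Set} (p : Fin m → X) (f g : Fin n → X) φ →
  formulaSize (proj₁ (substitute (atom ∘ p) (λ q → atom (f q) , atom (g q)) φ)) ≡ formulaSize φ
  × formulaSize (proj₂ (substitute (atom ∘ p) (λ q → atom (f q) , atom (g q)) φ)) ≡ formulaSize φ
substitute-size p f g ff             = refl , refl
substitute-size p f g tt             = refl , refl
substitute-size p f g (atom (par q)) = refl , refl
substitute-size p f g (atom (def q)) = refl , refl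
substitute-size p f g (∼ φ)          =
  let (a , b) = substitute-size p f g φ in cong (2 +_) b , cong (2 +_) a
substitute-size p f g (φ ⩓ ψ)        =
  let (a , b) = substitute-size p f g φ
      (c , d) = substitute-size p f g ψ
  in cong (3 +_) (cong₂ _+_ a c) , cong (3 +_) (cong₂ _+_ b d)
substitute-size p f g (φ ⩔ ψ)        =
  let (a , b) = substitute-size p f g φ
      (c , d) = substitute-size p f g ψ
  in cong (3 +_) (cong₂ _+_ a c) , cong (3 +_) (cong₂ _+_ b d)

gatesSize-mapG : ∀ (f : I → J) c → gatesSize (map (mapG f) c) ≡ gatesSize c
gatesSize-mapG f []            = refl
gatesSize-mapG f (input _ ∷ c) = cong suc (gatesSize-mapG f c)
gatesSize-mapG f (const _ ∷ c) = cong suc (gatesSize-mapG f c)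
gatesSize-mapG f (inv _   ∷ c) = cong (2 +_) (gatesSize-mapG f c)
gatesSize-mapG f (and _ _ ∷ c) = cong (3 +_) (gatesSize-mapG f c)
gatesSize-mapG f (or _ _  ∷ c) = cong (3 +_) (gatesSize-mapG f c)

module Sizes {m n : ℕ} (P : Program m n) where
  open Semantics P

  layer : ℕ
  layer = n * (1 + rulesSize P * 6)

  wired₁-size : ∀ xs ys c → gatesSize (proj₁ (buildAll (proj₁ ∘ wired P xs ys) c)) ≤
                            layer + gatesSize c
  wired₁-size xs ys c = buildAll-size _ c λ q →
    ≤-trans (≤-reflexive (proj₁ (substitute-size inp _ _ (φ[ P ] q)))) (φ-size P q)

  wired₂-size : ∀ xs ys c → gatesSize (proj₁ (buildAll (proj₂ ∘ wired P xs ys) c)) ≤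
                            layer + gatesSize c
  wired₂-size xs ys c = buildAll-size _ c λ q →
    ≤-trans (≤-reflexive (proj₂ (substitute-size inp _ _ (φ[ P ] q)))) (φ-size P q)

  applied-size : ∀ S → gatesSize (pool (applied P S)) ≤ layer + layer + gatesSize (pool S)
  applied-size (state c xs ys) = begin
    _                                ≤⟨ wired₂-size xs ys _ ⟩
    layer + _                        ≤⟨ +-monoʳ-≤ layer (wired₁-size xs ys c) ⟩
    layer + (layer + gatesSize c)    ≡⟨ +-assoc layer layer _ ⟨
    layer + layer + gatesSize c      ∎
    where open ≤-Reasoning

  iterated-size : ∀ xs k c → gatesSize (proj₁ (iterated P xs k c)) ≤
                             k * layer + (1 + gatesSize c)
  iterated-size xs zero    c = ≤-refl
  iterated-size xs (suc k) c = begin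
    _                                          ≤⟨ wired₂-size xs (proj₂ (iterated P xs k c)) _ ⟩
    layer + _                                  ≤⟨ +-monoʳ-≤ layer (iterated-size xs k c) ⟩
    layer + (k * layer + (1 + gatesSize c))    ≡⟨ +-assoc layer (k * layer) _ ⟨
    layer + k * layer + (1 + gatesSize c)      ∎
    where open ≤-Reasoning

  -- An application adds two layers, a fixpoint iteration one; the extra 1 pays for the constant
  -- from which the iterations start.
  stepSize : ℕ
  stepSize = 1 + (layer + layer)

  run-size : ∀ {S} (ρ : Run P S) → gatesSize (pool S) ≤ 2 + steps ρ * stepSize
  run-size start = ≤-refl
  run-size {S} (apply {S₀} ρ app) rewrite Application.constructed app = begin
    gatesSize (pool (applied P S₀))                   ≤⟨ applied-size S₀ ⟩
    layer + layer + gatesSize (pool S₀)               ≤⟨ +-mono-≤ (n≤1+n (layer + layer)) (run-size ρ) ⟩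
    stepSize + (2 + steps ρ * stepSize)               ≡⟨ +-comm stepSize _ ⟩
    2 + steps ρ * stepSize + stepSize                 ≡⟨ cong (2 +_) (+-comm _ stepSize) ⟩
    2 + suc (steps ρ) * stepSize                      ∎
    where open ≤-Reasoning
  run-size {S} (refound {S₀} ρ _ u) rewrite Unfoundedness.constructed u = begin
    _                                                 ≤⟨ iterated-size (𝔖ₜ S₀) k (pool S₀) ⟩
    k * layer + (1 + gatesSize (pool S₀))             ≤⟨ +-mono-≤ (*-monoʳ-≤ k layer≤) (s≤s (run-size ρ)) ⟩
    k * stepSize + (3 + steps ρ * stepSize)           ≡⟨ +-comm (k * stepSize) _ ⟩
    2 + (1 + steps ρ * stepSize + k * stepSize)       ≤⟨ +-monoʳ-≤ 2 (+-monoˡ-≤ (k * stepSize) (+-monoˡ-≤ (steps ρ * stepSize) (s≤s z≤n))) ⟩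
    2 + (stepSize + steps ρ * stepSize + k * stepSize) ≡⟨ cong (2 +_) (+-assoc stepSize _ _) ⟩
    2 + (stepSize + (steps ρ * stepSize + k * stepSize)) ≡⟨ cong (λ x → 2 + (stepSize + x)) (+-comm (steps ρ * stepSize) _) ⟩
    2 + (stepSize + (k * stepSize + steps ρ * stepSize)) ≡⟨ cong (λ x → 2 + (stepSize + x)) (*-distribʳ-+ stepSize k (steps ρ)) ⟨
    2 + (suc k + steps ρ) * stepSize                  ∎
    where
    open ≤-Reasoning
    k = iterations u
    layer≤ : layer ≤ stepSize
    layer≤ = ≤-trans (m≤m+n layer layer) (n≤1+n _)

  theory-size : ∀ S → sizeC (theory S) ≤ (1 + n * 20) + gatesSize (pool S)
  theory-size S = begin
    sizeC (theory S)                                  ≤⟨ build-size conjunction _ ⟩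
    formulaSize conjunction + gatesSize (map (mapG par) (pool S))
      -- An equivalence of two leaves weighs 17: 5 for the conjunction, 9 for that of the negations
      -- and 3 for the disjunction. The gate joining it to the other conjuncts makes 20.
      ≤⟨ +-mono-≤ (⋀-size conjunct (λ _ → ≤-refl) (allFin n)) (≤-reflexive (gatesSize-mapG par (pool S))) ⟩
    1 + length (allFin n) * 20 + gatesSize (pool S)
      ≡⟨ cong (λ l → 1 + l * 20 + gatesSize (pool S)) (length-tabulate {n = n} id) ⟩
    (1 + n * 20) + gatesSize (pool S)                 ∎
    where
    open ≤-Reasoning
    conjunct : Fin n → Formula (Leaf (Atom m n))
    conjunct q = atom (inp (def q)) ⇿ atom (wire (lookup (𝔖ₜ S) q))
    conjunction = ⋀ (map conjunct (allFin n))

  output-size : ∀ {S} (ρ : Run P S) → sizeC (theory S) ≤ (1 + n * 20) + (2 + steps ρ * stepSize)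
  output-size {S} ρ = ≤-trans (theory-size S) (+-monoʳ-≤ (1 + n * 20) (run-size ρ))

  -- Bounds for economical runs

  -- A strict refinement shows that the count before it had not reached `n + n`, as otherwise the
  -- state would be stable. Every completed round is charged `n + n` applications, its own
  -- transition and `n` iterations; the last summand covers the applications since the latest round.
  economical-bound : ∀ {S} (ρ : Run P S) → Economical ρ →
    applies ρ ≤ n + n × rounds ρ ≤ n + n × steps ρ ≤ rounds ρ * (suc n + (n + n)) + applies ρ
  economical-bound start _ = z≤n , z≤n , z≤n
  economical-bound (apply ρ app) (eco , _ , S≉) with economical-bound ρ eco
  ... | _ , r≤ , s≤ =
    ≰⇒> (λ h → S≉ (application-not-strict app (enough-applies ρ h))) , r≤ ,
    ≤-trans (s≤s s≤) (≤-reflexive (sym (+-suc _ (applies ρ))))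
  economical-bound (refound ρ noApp u) (eco , (_ , S≉) , minimal) with economical-bound ρ eco
  ... | a≤ , _ , s≤ =
    z≤n , ≰⇒> (λ h → S≉ (unfoundedness-not-strict u (proj₂ ∘ enough-rounds ρ h))) ,
    (begin
      suc k + steps ρ                      ≤⟨ +-mono-≤ (s≤s k≤n) s≤ ⟩
      suc n + (rounds ρ * w + applies ρ)   ≤⟨ +-monoʳ-≤ (suc n) (+-monoʳ-≤ (rounds ρ * w) a≤) ⟩
      suc n + (rounds ρ * w + (n + n))     ≡⟨ cong (suc n +_) (+-comm (rounds ρ * w) _) ⟩
      suc n + (n + n + rounds ρ * w)       ≡⟨ +-assoc (suc n) (n + n) _ ⟨
      w + rounds ρ * w                     ≡⟨ +-identityʳ _ ⟨
      w + rounds ρ * w + 0                 ∎)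
    where
    open ≤-Reasoning
    k = iterations u
    w = suc n + (n + n)
    -- The `n`-th iterate is always founded, so minimality rules out `n < k`.
    k≤n : k ≤ n
    k≤n = ≮⇒≥ λ n<k → minimal n n<k (refounded-founded ρ)

  economical-steps : ∀ {S} (ρ : Run P S) → Economical ρ →
                     steps ρ ≤ (n + n) * (suc n + (n + n)) + (n + n)
  economical-steps ρ eco =
    let (a≤ , r≤ , s≤) = economical-bound ρ eco
    in ≤-trans s≤ (+-mono-≤ (*-monoˡ-≤ (suc n + (n + n)) r≤) a≤)

-- A complete run

appliedTimes : ∀ {m n} → Program m n → ℕ → State m n → State m n
appliedTimes P zero    S = S
appliedTimes P (suc k) S = applied P (appliedTimes P k S)

round : ∀ {m n} → Program m n → State m n → State m n
round {n = n} P S = refounded P (appliedTimes P (n + n) S) n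

roundTimes : ∀ {m n} → Program m n → ℕ → State m n
roundTimes P zero    = initial
roundTimes P (suc k) = round P (roundTimes P k)

compiled : ∀ {m n} → Program m n → State m n
compiled {n = n} P = roundTimes P (n + n)

module CompleteRun {m n : ℕ} (P : Program m n) where
  open Semantics P
  open Sizes P

  appliedTimes-run : ∀ {S} (ρ : Run P S) k → Σ[ ρ′ ∈ Run P (appliedTimes P k S) ]
    applies ρ′ ≡ k + applies ρ × rounds ρ′ ≡ rounds ρ × steps ρ′ ≡ k + steps ρ
  appliedTimes-run ρ zero    = ρ , refl , refl , refl
  appliedTimes-run ρ (suc k) =
    let (ρ′ , a , r , s) = appliedTimes-run ρ k
    in apply ρ′ (applied-application ρ′) , cong suc a , r , cong suc s

  roundTimes-run : ∀ k → Σ[ ρ ∈ Run P (roundTimes P k) ]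
    rounds ρ ≡ k × steps ρ ≡ k * (suc n + (n + n))
  roundTimes-run zero    = start , refl , refl
  roundTimes-run (suc k) =
    let (ρ , r , s) = roundTimes-run k
        (ρ′ , a′ , r′ , s′) = appliedTimes-run ρ (n + n)
        stable = enough-applies ρ′ (≤-trans (m≤m+n (n + n) (applies ρ)) (≤-reflexive (sym a′)))
    -- The priority of applications is respected without any test: the `n + n` applications just
    -- made leave no strict one.
    in refound ρ′ (λ S′ app (_ , S≉) → S≉ (application-not-strict app stable))
         (refounded-unfoundedness ρ′) ,
       cong suc (trans r′ r) ,
       trans (cong (suc n +_) (trans s′ (cong (n + n +_) s))) (sym (+-assoc (suc n) (n + n) _))

  compiled-run : Run P (compiled P)
  compiled-run = proj₁ (roundTimes-run (n + n))

  compiled-steps : steps compiled-run ≡ (n + n) * (suc n + (n + n))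
  compiled-steps = proj₂ (proj₂ (roundTimes-run (n + n)))

  compiled-done : ∀ v → Done v (atₚ v ⟦ compiled P ⟧)
  compiled-done = enough-rounds compiled-run
    (≤-reflexive (sym (proj₁ (proj₂ (roundTimes-run (n + n))))))

  module _ (S : State m n) (val : Valid S) where

    private
      gatesₐ : Gates (Atom m n)
      gatesₐ = map (mapG par) (pool S)

      conjunct : Fin n → Formula (Leaf (Atom m n))
      conjunct q = atom (inp (def q)) ⇿ atom (wire (lookup (𝔖ₜ S) q))

      conjuncts-below : ∀ qs → WiresBelow (length gatesₐ) (⋀ (map conjunct qs))
      conjuncts-below []       = tt
      conjuncts-below (q ∷ qs) = ((tt , below) , (tt , below)) , conjuncts-below qs
        where
        below : lookup (𝔖ₜ S) q < length gatesₐ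
        below = subst (lookup (𝔖ₜ S) q <_) (sym (length-map (mapG par) (pool S))) (𝔖ₜ< val q)

      conjuncts-eval : ∀ v qs → eval (leafValue v gatesₐ) (⋀ (map conjunct qs)) ≡
        eval v (⋀ (map (λ q → atom (def q) ⇿ mapF par (proj₁ ⟦ S ⟧ q)) qs))
      conjuncts-eval v []       = refl
      conjuncts-eval v (q ∷ qs) = cong₂ _∧_
        (cong (λ φ → eval v (atom (def q) ⇿ φ)) (formulaAt-mapG par (pool S) (lookup (𝔖ₜ S) q)))
        (conjuncts-eval v qs)

    theory-builds : Builds gatesₐ (⋀ (map conjunct (allFin n))) (gates (theory S)) (output (theory S))
    theory-builds = build-correct _ gatesₐ (AllWellWired-mapG par (pool S) (pool-wired val))
                      (conjuncts-below (allFin n))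

    theory-represents : formulaAt (gates (theory S)) (output (theory S)) ≈ Th (proj₁ ⟦ S ⟧)
    theory-represents = (λ v → subst T (value v)) , (λ v → subst T (sym (value v)))
      where
      value : ∀ v → eval v (formulaAt (gates (theory S)) (output (theory S))) ≡
                    eval v (Th (proj₁ ⟦ S ⟧))
      value v = trans (computes theory-builds v) (conjuncts-eval v (allFin n))

  compile-complete : Compile P (theory (compiled P))
  compile-complete = record
    { final       = compiled P
    ; run         = compiled-run
    ; terminal    =
        (λ S′ app (_ , S≉) → S≉ (application-not-strict app (proj₁ ∘ compiled-done))) ,
        (λ S′ u (_ , S≉) → S≉ (unfoundedness-not-strict u (proj₂ ∘ compiled-done)))
    ; model       = Done⇒model compiled-run compiled-done
    ; constructed = refl
    ; wellFormed  = wellW built , inRange built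
    ; represents  = theory-represents (compiled P) (run-valid compiled-run) }
    where built = theory-builds (compiled P) (run-valid compiled-run)

-- Polynomial bounds

-- With base `suc s` powers are monotone in the exponent even at `s = 0`, so one monomial bounds
-- every sum and product without an additive constant.
Polynomial : (ℕ → ℕ) → Set
Polynomial f = ∃[ c ] ∃[ k ] (∀ s → f s ≤ c * suc s ^ k)

const-polynomial : ∀ a → Polynomial (λ _ → a)
const-polynomial a = a , 0 , λ s → ≤-reflexive (sym (*-identityʳ a))

id-polynomial : Polynomial id
id-polynomial = 1 , 1 , λ s →
  ≤-trans (n≤1+n s) (≤-reflexive (sym (trans (*-identityˡ _) (^-identityʳ (suc s)))))

+-polynomial : ∀ {f g} → Polynomial f → Polynomial g → Polynomial (λ s → f s + g s)
+-polynomial {f} {g} (c , k , hf) (d , l , hg) = c + d , k + l , λ s → begin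
  f s + g s                                     ≤⟨ +-mono-≤ (hf s) (hg s) ⟩
  c * suc s ^ k + d * suc s ^ l
    ≤⟨ +-mono-≤ (*-monoʳ-≤ c (^-monoʳ-≤ (suc s) (m≤m+n k l)))
                (*-monoʳ-≤ d (^-monoʳ-≤ (suc s) (m≤n+m l k))) ⟩
  c * suc s ^ (k + l) + d * suc s ^ (k + l)     ≡⟨ *-distribʳ-+ (suc s ^ (k + l)) c d ⟨
  (c + d) * suc s ^ (k + l)                     ∎
  where open ≤-Reasoning

*-polynomial : ∀ {f g} → Polynomial f → Polynomial g → Polynomial (λ s → f s * g s)
*-polynomial {f} {g} (c , k , hf) (d , l , hg) = c * d , k + l , λ s → begin
  f s * g s                             ≤⟨ *-mono-≤ (hf s) (hg s) ⟩
  c * suc s ^ k * (d * suc s ^ l)       ≡⟨ [m*n]*[o*p]≡[m*o]*[n*p] c (suc s ^ k) d (suc s ^ l) ⟩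
  c * d * (suc s ^ k * suc s ^ l)       ≡⟨ cong (c * d *_) (^-distribˡ-+-* (suc s) k l) ⟨
  c * d * suc s ^ (k + l)               ∎
  where open ≤-Reasoning

-- For positive `s` the base `suc s` is at most `2 * s`; at `s = 0` the additive constant of `poly`
-- takes over.
suc^≤ : ∀ s k → suc s ^ k ≤ 2 ^ k * s ^ k + 2 ^ k
suc^≤ zero k = begin
  1 ^ k                   ≡⟨ ^-zeroˡ k ⟩
  1                       ≤⟨ m^n>0 2 k ⟩
  2 ^ k                   ≤⟨ m≤n+m (2 ^ k) (2 ^ k * 0 ^ k) ⟩
  2 ^ k * 0 ^ k + 2 ^ k   ∎
  where open ≤-Reasoning
suc^≤ (suc s) k = begin
  (2 + s) ^ k                   ≤⟨ ^-monoˡ-≤ k 2+s≤ ⟩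
  (2 * suc s) ^ k               ≡⟨ ^-distribʳ-* k 2 (suc s) ⟩
  2 ^ k * suc s ^ k             ≤⟨ m≤m+n _ (2 ^ k) ⟩
  2 ^ k * suc s ^ k + 2 ^ k     ∎
  where
  open ≤-Reasoning
  2+s≤ : 2 + s ≤ 2 * suc s
  2+s≤ = s≤s (≤-trans (s≤s (m≤m+n s 0)) (m≤n+m (suc (s + 0)) s))
  ^-distribʳ-* : ∀ k a b → (a * b) ^ k ≡ a ^ k * b ^ k
  ^-distribʳ-* zero    a b = refl
  ^-distribʳ-* (suc k) a b =
    trans (cong (a * b *_) (^-distribʳ-* k a b)) ([m*n]*[o*p]≡[m*o]*[n*p] a b (a ^ k) (b ^ k))

Polynomial⇒poly : ∀ {f} → Polynomial f → ∃[ c ] ∃[ k ] (∀ s → f s ≤ poly c k s)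
Polynomial⇒poly {f} (c , k , h) = c * 2 ^ k , k , λ s → begin
  f s                                     ≤⟨ h s ⟩
  c * suc s ^ k                           ≤⟨ *-monoʳ-≤ c (suc^≤ s k) ⟩
  c * (2 ^ k * s ^ k + 2 ^ k)             ≡⟨ *-distribˡ-+ c _ (2 ^ k) ⟩
  c * (2 ^ k * s ^ k) + c * 2 ^ k         ≡⟨ cong (_+ c * 2 ^ k) (*-assoc c (2 ^ k) (s ^ k)) ⟨
  c * 2 ^ k * s ^ k + c * 2 ^ k           ∎
  where open ≤-Reasoning

-- Evaluation with a syntactic cost bound

-- Bounds the cost of every evaluation whose recursions have length at most N.
costBound : ℕ → Γ ⊢ A → ℕ
costBound N (var i)         = 1
costBound N (bind e f)      = 1 + costBound N e + costBound N f
costBound N unit            = 1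
costBound N (pair e f)      = 1 + costBound N e + costBound N f
costBound N (fst e)         = 1 + costBound N e
costBound N (snd e)         = 1 + costBound N e
costBound N (inl e)         = 1 + costBound N e
costBound N (inr e)         = 1 + costBound N e
costBound N (case e f g)    = 1 + costBound N e + (costBound N f + costBound N g)
costBound N zero            = 1
costBound N (suc e)         = 1 + costBound N e
costBound N (recNat e z s)  = 1 + costBound N e + (costBound N z + N * costBound N s)
costBound N nil             = 1
costBound N (cons e f)      = 1 + costBound N e + costBound N f
costBound N (recList e z s) = 1 + costBound N e + (costBound N z + N * costBound N s)

-- For a fixed term `costBound` is built from `N` and constants by finitely many sums and products,
-- with one factor `N` for each nested recursion.
costBound-polynomial : ∀ {N} → Polynomial N → (e : Γ ⊢ A) → Polynomial (λ s → costBound (N s) e)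
costBound-polynomial {N = N} pN = go
  where
  1+_ : ∀ {f} → Polynomial f → Polynomial (λ s → 1 + f s)
  1+_ {f} = +-polynomial {λ _ → 1} {f} (const-polynomial 1)
  go : ∀ {Γ A} (e : Γ ⊢ A) → Polynomial (λ s → costBound (N s) e)
  two : ∀ {Γ Δ A B} (e : Γ ⊢ A) (f : Δ ⊢ B) →
        Polynomial (λ s → 1 + costBound (N s) e + costBound (N s) f)
  two e f = +-polynomial {λ s → 1 + costBound (N s) e} (1+ go e) (go f)
  rec : ∀ {Γ Δ Ω A B C} (e : Γ ⊢ A) (f : Δ ⊢ B) (g : Ω ⊢ C) →
        Polynomial (λ s → 1 + costBound (N s) e + (costBound (N s) f + N s * costBound (N s) g))
  rec e f g = +-polynomial {λ s → 1 + costBound (N s) e} (1+ go e)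
    (+-polynomial {λ s → costBound (N s) f} (go f) (*-polynomial {N} pN (go g)))
  go (var i)         = const-polynomial 1
  go (bind e f)      = two e f
  go unit            = const-polynomial 1
  go (pair e f)      = two e f
  go (fst e)         = 1+ go e
  go (snd e)         = 1+ go e
  go (inl e)         = 1+ go e
  go (inr e)         = 1+ go e
  go (case e f g)    = +-polynomial {λ s → 1 + costBound (N s) e} (1+ go e)
    (+-polynomial {λ s → costBound (N s) f} (go f) (go g))
  go zero            = const-polynomial 1
  go (suc e)         = 1+ go e
  go (recNat e z s)  = rec e z s
  go nil             = const-polynomial 1
  go (cons e f)      = two e f
  go (recList e z s) = rec e z s

module Evaluation (N : ℕ) where

  infix 3 _∋_⇓_

  -- Value and cost are established together: the cost of a recursion depends on the length of a
  -- computed value and on all its intermediate accumulators.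
  record _∋_⇓_ (ε : Env Γ) (e : Γ ⊢ A) (v : Val A) : Set where
    constructor evaluates
    field
      result≡ : result e ε ≡ v
      cost≤   : cost e ε ≤ costBound N e

  open _∋_⇓_ public

  private variable
    ε : Env Γ

  ⇓-≡ : {e : Γ ⊢ A} {v w : Val A} → v ≡ w → ε ∋ e ⇓ v → ε ∋ e ⇓ w
  ⇓-≡ refl d = d

  var⇓ : {i : A ∈ Γ} {v : Val A} → All.lookup ε i ≡ v → ε ∋ var i ⇓ v
  var⇓ p = evaluates p ≤-refl

  bind⇓ : {e : Γ ⊢ A} {f : A ∷ Γ ⊢ B} {v : Val A} {w : Val B} →
          ε ∋ e ⇓ v → (v ∷ ε) ∋ f ⇓ w → ε ∋ bind e f ⇓ w
  bind⇓ (evaluates refl p) (evaluates q r) = evaluates q (s≤s (+-mono-≤ p r))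

  unit⇓ : ε ∋ unit ⇓ tt
  unit⇓ = evaluates refl ≤-refl

  pair⇓ : {e : Γ ⊢ A} {f : Γ ⊢ B} {v : Val A} {w : Val B} →
          ε ∋ e ⇓ v → ε ∋ f ⇓ w → ε ∋ pair e f ⇓ (v , w)
  pair⇓ (evaluates p c) (evaluates q d) = evaluates (cong₂ _,_ p q) (s≤s (+-mono-≤ c d))

  fst⇓ : {e : Γ ⊢ A ⊗ B} {v : Val (A ⊗ B)} → ε ∋ e ⇓ v → ε ∋ fst e ⇓ proj₁ v
  fst⇓ (evaluates p c) = evaluates (cong proj₁ p) (s≤s c)

  snd⇓ : {e : Γ ⊢ A ⊗ B} {v : Val (A ⊗ B)} → ε ∋ e ⇓ v → ε ∋ snd e ⇓ proj₂ v
  snd⇓ (evaluates p c) = evaluates (cong proj₂ p) (s≤s c)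

  inl⇓ : {e : Γ ⊢ A} {v : Val A} → ε ∋ e ⇓ v → ε ∋ inl {B = B} e ⇓ inj₁ v
  inl⇓ (evaluates p c) = evaluates (cong inj₁ p) (s≤s c)

  inr⇓ : {e : Γ ⊢ B} {v : Val B} → ε ∋ e ⇓ v → ε ∋ inr {A = A} e ⇓ inj₂ v
  inr⇓ (evaluates p c) = evaluates (cong inj₂ p) (s≤s c)

  case⇓₁ : {e : Γ ⊢ A ⊕ B} {f : A ∷ Γ ⊢ D} {g : B ∷ Γ ⊢ D} {v : Val A} {w : Val D} →
           ε ∋ e ⇓ inj₁ v → (v ∷ ε) ∋ f ⇓ w → ε ∋ case e f g ⇓ w
  case⇓₁ {ε = ε} {e = e} {f} {g} {v} {w} (evaluates p c) (evaluates q d) = evaluates value bounded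
    where
    value : result (case e f g) ε ≡ w
    value rewrite p = q
    bounded : cost (case e f g) ε ≤ costBound N (case e f g)
    bounded rewrite p = s≤s (+-mono-≤ c (≤-trans d (m≤m+n _ _)))

  case⇓₂ : {e : Γ ⊢ A ⊕ B} {f : A ∷ Γ ⊢ D} {g : B ∷ Γ ⊢ D} {v : Val B} {w : Val D} →
           ε ∋ e ⇓ inj₂ v → (v ∷ ε) ∋ g ⇓ w → ε ∋ case e f g ⇓ w
  case⇓₂ {ε = ε} {e = e} {f} {g} {v} {w} (evaluates p c) (evaluates q d) = evaluates value bounded
    where
    value : result (case e f g) ε ≡ w
    value rewrite p = q
    bounded : cost (case e f g) ε ≤ costBound N (case e f g)
    bounded rewrite p = s≤s (+-mono-≤ c (≤-trans d (m≤n+m _ _)))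

  zero⇓ : ε ∋ zero ⇓ 0
  zero⇓ = evaluates refl ≤-refl

  suc⇓ : {e : Γ ⊢ nat} {k : ℕ} → ε ∋ e ⇓ k → ε ∋ suc e ⇓ suc k
  suc⇓ (evaluates p c) = evaluates (cong suc p) (s≤s c)

  nil⇓ : ε ∋ nil {A = A} ⇓ []
  nil⇓ = evaluates refl ≤-refl

  cons⇓ : {e : Γ ⊢ A} {f : Γ ⊢ list A} {v : Val A} {vs : List (Val A)} →
          ε ∋ e ⇓ v → ε ∋ f ⇓ vs → ε ∋ cons e f ⇓ (v ∷ vs)
  cons⇓ (evaluates p c) (evaluates q d) = evaluates (cong₂ _∷_ p q) (s≤s (+-mono-≤ c d))

  -- `f` predicts the accumulator after each step, so the body of the recursion has to be analysed
  -- only at accumulators that really occur.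
  recNat⇓ : {e : Γ ⊢ nat} {z : Γ ⊢ D} {s : D ∷ nat ∷ Γ ⊢ D} {k : ℕ} (f : ℕ → Val D) →
            ε ∋ e ⇓ k → k ≤ N → ε ∋ z ⇓ f 0 →
            (∀ j → j < k → (f j ∷ j ∷ ε) ∋ s ⇓ f (suc j)) →
            ε ∋ recNat e z s ⇓ f k
  recNat⇓ {ε = ε} {e} {z} {s} {k} f (evaluates refl c) k≤N (evaluates q d) step =
    evaluates (proj₁ (go k ≤-refl))
      (s≤s (+-mono-≤ c (≤-trans (proj₂ (go k ≤-refl))
        (+-monoʳ-≤ (costBound N z) (*-monoˡ-≤ (costBound N s) k≤N)))))
    where
    value : ℕ → Val _
    value = primNat (result z ε) (λ j d → result s (d ∷ j ∷ ε))
    go : ∀ j → j ≤ k → value j ≡ f j ×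
         primNat (cost z ε) (λ j t → t + cost s (value j ∷ j ∷ ε)) j ≤
         costBound N z + j * costBound N s
    go zero    _   = q , ≤-trans d (m≤m+n _ 0)
    go (suc j) j<k with go j (<⇒≤ j<k) | step j j<k
    ... | p , b | evaluates r b′ rewrite p = r , ≤-trans (+-mono-≤ b b′)
      (≤-reflexive (trans (+-assoc (costBound N z) _ _) (cong (costBound N z +_) (+-comm _ (costBound N s)))))

  -- The data are encodings `map g xs`, while the prediction `f` speaks of the encoded objects; `Q`
  -- carries a bound on each element into the step, such as the length of a rule body.
  recList⇓ : ∀ {X : Set} {e : Γ ⊢ list A} {z : Γ ⊢ D} {s : D ∷ A ∷ list A ∷ Γ ⊢ D} {Q : X → Set}
             (g : X → Val A) (f : List X → Val D) {xs : List X} →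
             ε ∋ e ⇓ map g xs → length xs ≤ N → All Q xs → ε ∋ z ⇓ f [] →
             (∀ x xs → Q x → (f xs ∷ g x ∷ map g xs ∷ ε) ∋ s ⇓ f (x ∷ xs)) →
             ε ∋ recList e z s ⇓ f xs
  recList⇓ {ε = ε} {e = e} {z} {s} g f {xs} (evaluates p c) xs≤N qs (evaluates q d) step =
    evaluates (trans (cong value p) (proj₁ (go xs qs)))
      (s≤s (+-mono-≤ c (≤-trans (≤-trans (≤-reflexive (cong costs p)) (proj₂ (go xs qs)))
        (+-monoʳ-≤ (costBound N z) (*-monoˡ-≤ (costBound N s) xs≤N)))))
    where
    value : List (Val _) → Val _
    value = primList (result z ε) (λ a as d → result s (d ∷ a ∷ as ∷ ε))
    costs : List (Val _) → ℕ
    costs = primList (cost z ε) (λ a as t → t + cost s (value as ∷ a ∷ as ∷ ε))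
    go : ∀ xs → All _ xs → value (map g xs) ≡ f xs ×
         costs (map g xs) ≤ costBound N z + length xs * costBound N s
    go []       _        = q , ≤-trans d (m≤m+n _ 0)
    go (x ∷ xs) (h ∷ hs) with go xs hs | step x xs h
    ... | p , b | evaluates r b′ rewrite p = r , ≤-trans (+-mono-≤ b b′)
      (≤-reflexive (trans (+-assoc (costBound N z) _ _) (cong (costBound N z +_) (+-comm _ (costBound N s)))))

-- The implementation

pattern v₀ = here refl
pattern v₁ = there v₀
pattern v₂ = there v₁
pattern v₃ = there v₂
pattern v₄ = there v₃
pattern v₅ = there v₄
pattern v₆ = there v₅
pattern v₇ = there v₆
pattern v₈ = there v₇
pattern v₉ = there v₈
pattern ↑² i = there (there i)
pattern ↑³ i = there (↑² i)
pattern ↑⁴ i = there (↑³ i)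
pattern ↑⁵ i = there (↑⁴ i)
pattern ↑⁶ i = there (↑⁵ i)
pattern ↑⁷ i = there (↑⁶ i)

-- A pool carries its length, so that adding a gate takes constant time.
poolTy builtTy stateTy : Ty
poolTy  = list gateTy ⊗ nat
builtTy = poolTy ⊗ nat
stateTy = poolTy ⊗ list nat ⊗ list nat

-- Case analysis on lists and numbers is a recursion that ignores its accumulator. In the step of
-- `recList`, `v₀` is the accumulator, `v₁` the head and `v₂` the tail.
tailT : list nat ∈ Γ → Γ ⊢ list nat
tailT l = recList (var l) nil (var v₂)

lookupT : list nat ∈ Γ → nat ∈ Γ → Γ ⊢ nat
lookupT xs q = recList (recNat (var q) (var xs) (tailT v₀)) zero (var v₁)

predT : nat ∈ Γ → Γ ⊢ nat
predT d = recNat (var d) zero (var v₁)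

monusT : nat ∈ Γ → nat ∈ Γ → Γ ⊢ nat
monusT a b = recNat (var b) (var a) (predT v₀)

equalT : nat ∈ Γ → nat ∈ Γ → Γ ⊢ boolTy
equalT a b =
  recNat (monusT a b) (recNat (monusT b a) (inr unit) (inl unit)) (inl unit)

replicateT : nat ∈ Γ → list nat ∷ nat ∷ Γ ⊢ nat → Γ ⊢ list nat
replicateT n e = recNat (var n) nil (cons e (var v₀))

indicesT : nat ∈ Γ → Γ ⊢ list nat
indicesT n =
  recNat (var n) nil (cons zero (recList (var v₀) nil (cons (suc (var v₁)) (var v₀))))

inputT : Γ ⊢ atomTy → Γ ⊢ gateTy
inputT = inl

falseT trueT : Γ ⊢ gateTy
falseT = inr (inl (inl unit))
trueT  = inr (inl (inr unit))

invT : Γ ⊢ nat → Γ ⊢ gateTy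
invT r = inr (inr (inl r))

andT orT : Γ ⊢ nat → Γ ⊢ nat → Γ ⊢ gateTy
andT r s = inr (inr (inr (inl (pair r s))))
orT  r s = inr (inr (inr (inr (pair r s))))

addT : Γ ⊢ gateTy → poolTy ∈ Γ → Γ ⊢ builtTy
addT g c = pair (pair (cons g (fst (var c))) (suc (snd (var c)))) (snd (var c))

-- The pool just built becomes `v₀` and its pair `v₁`, so that `snd (var v₁)` is the newest name;
-- everything older moves by two positions.
thenT : Γ ⊢ A ⊗ B → A ∷ A ⊗ B ∷ Γ ⊢ D → Γ ⊢ D
thenT e f = bind e (bind (fst (var v₀)) f)

literalT : literalTy ∈ Γ → list nat ∈ Γ → list nat ∈ Γ → poolTy ∈ Γ → Γ ⊢ builtTy
literalT l xs ys c = case (var l)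
  (case (var v₀)
    (addT (inputT (inl (var v₀))) (↑² c))
    (pair (var (↑² c)) (lookupT (↑² xs) v₀)))
  (case (var v₀)
    (thenT (addT (inputT (inl (var v₀))) (↑² c)) (addT (invT (snd (var v₁))) v₀))
    (addT (invT (lookupT (↑² ys) v₀)) (↑² c)))

bodyT : list literalTy ∈ Γ → list nat ∈ Γ → list nat ∈ Γ → poolTy ∈ Γ → Γ ⊢ builtTy
bodyT ls xs ys c = recList (var ls) (addT trueT c)
  (bind (fst (var v₀))
    (thenT (literalT v₂ (↑⁴ xs) (↑⁴ ys) v₀)
      (addT (andT (snd (var v₁)) (snd (var v₃))) v₀)))

definitionT : list ruleTy ∈ Γ → nat ∈ Γ → list nat ∈ Γ → list nat ∈ Γ → poolTy ∈ Γ → Γ ⊢ builtTy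
definitionT rs q xs ys c = recList (var rs) (addT falseT c)
  (bind (fst (var v₁))
    (case (equalT v₀ (↑⁴ q))
      (var v₂)
      (bind (snd (var v₃))
        (bind (fst (var v₃))
          (thenT (bodyT v₁ (↑⁷ xs) (↑⁷ ys) v₀)
            (addT (orT (snd (var v₁)) (snd (var v₆))) v₀))))))

layerT : list nat ∈ Γ → list ruleTy ∈ Γ → list nat ∈ Γ → list nat ∈ Γ → poolTy ∈ Γ →
         Γ ⊢ poolTy ⊗ list nat
layerT qs rs xs ys c = recList (var qs) (pair (var c) nil)
  (bind (fst (var v₀))
    (bind (definitionT (↑⁴ rs) v₂ (↑⁴ xs) (↑⁴ ys) v₀)
      (pair (fst (var v₀)) (cons (snd (var v₀)) (snd (var v₂))))))

appliedT : list nat ∈ Γ → list ruleTy ∈ Γ → stateTy ∈ Γ → Γ ⊢ stateTy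
appliedT qs rs S =
  bind (fst (var S))
    (bind (fst (snd (var (there S))))
      (bind (snd (snd (var (↑² S))))
        (thenT (layerT (↑³ qs) (↑³ rs) v₁ v₀ v₂)
          -- The upper bounds come from the same term with the roles of the two vectors exchanged.
          (bind (layerT (↑⁵ qs) (↑⁵ rs) v₂ v₃ v₀)
            (pair (fst (var v₀)) (pair (snd (var v₂)) (snd (var v₀))))))))

refoundedT : nat ∈ Γ → list nat ∈ Γ → list ruleTy ∈ Γ → stateTy ∈ Γ → Γ ⊢ stateTy
refoundedT n qs rs S =
  bind (fst (var S))
    (bind (fst (snd (var (there S))))
      (bind (recNat (var (↑² n))
              (thenT (addT falseT v₁)
                (pair (var v₀) (replicateT (↑⁴ n) (snd (var v₃)))))
              (thenT (var v₀)
                (bind (snd (var v₁)) (layerT (↑⁷ qs) (↑⁷ rs) v₀ v₅ v₁))))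
        (pair (fst (var v₀)) (pair (var v₁) (snd (var v₀))))))

initialT : nat ∈ Γ → Γ ⊢ stateTy
initialT n =
  bind (pair nil zero)
    (thenT (addT falseT v₀)
      (thenT (addT trueT v₀)
        (pair (var v₀) (pair (replicateT (↑⁵ n) (snd (var v₅)))
                             (replicateT (↑⁵ n) (snd (var v₃)))))))

compiledT : nat ∈ Γ → nat ∈ Γ → list nat ∈ Γ → list ruleTy ∈ Γ → Γ ⊢ stateTy
compiledT n k qs rs = recNat (var k) (initialT n)
  (bind (recNat (var (↑² k)) (var v₀) (appliedT (↑⁴ qs) (↑⁴ rs) v₀))
    (refoundedT (↑³ n) (↑³ qs) (↑³ rs) v₀))

theoryT : list nat ∈ Γ → list nat ∈ Γ → poolTy ∈ Γ → Γ ⊢ builtTy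
theoryT qs xs c = recList (var qs) (addT trueT c)
  (bind (lookupT (↑³ xs) v₁)
    (bind (fst (var v₁))
      -- The order of the gates is dictated by `build`, which treats right arguments before left
      -- ones: the conjunction of negations comes before the positive one, and in it the negated
      -- wire before the negated atom.
      (thenT (addT (invT (var v₁)) v₀)
        (thenT (addT (inputT (inr (var v₅))) v₀)
          (thenT (addT (invT (snd (var v₁))) v₀)
            (thenT (addT (andT (snd (var v₁)) (snd (var v₅))) v₀)
              (thenT (addT (inputT (inr (var (↑² v₉)))) v₀)
                (thenT (addT (andT (snd (var v₁)) (var (↑² v₉))) v₀)
                  (thenT (addT (orT (snd (var v₁)) (snd (var v₅))) v₀)
                    (addT (andT (snd (var v₁)) (snd (var (↑⁷ v₉)))) v₀))))))))))

implementation : Implementation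
implementation =
  bind (fst (snd (var v₀)))
    (bind (snd (snd (var v₁)))
      -- This is `n + n`, used for the rounds and for the applications in each of them.
      (bind (recNat (var v₁) (var v₁) (suc (var v₀)))
        (bind (indicesT v₂)
          (bind (compiledT v₃ v₁ v₀ v₂)
            (bind (fst (var v₀))
              (bind (fst (snd (var v₁)))
                (bind (theoryT v₃ v₀ v₁)
                  (pair (fst (fst (var v₀))) (snd (var v₀))))))))))

-- Correctness of the implementation

gateVal : (I → Val atomTy) → Gate I → Val gateTy
gateVal h (input i) = inj₁ (h i)
gateVal h (const b) = inj₂ (inj₁ (encodeBool b))
gateVal h (inv r)   = inj₂ (inj₂ (inj₁ r))
gateVal h (and r s) = inj₂ (inj₂ (inj₂ (inj₁ (r , s))))
gateVal h (or r s)  = inj₂ (inj₂ (inj₂ (inj₂ (r , s))))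

poolVal : (I → Val atomTy) → Gates I → Val poolTy
poolVal h c = map (gateVal h) c , length c

builtVal : (I → Val atomTy) → Gates I × ℕ → Val builtTy
builtVal h (c , r) = poolVal h c , r

layerVal : ∀ {k} → (I → Val atomTy) → Gates I × Vec ℕ k → Val (poolTy ⊗ list nat)
layerVal h (c , rs) = poolVal h c , toList rs

parVal : ∀ {m} → Fin m → Val atomTy
parVal i = inj₁ (toℕ i)

stateVal : ∀ {m n} → State m n → Val stateTy
stateVal (state c xs ys) = poolVal parVal c , toList xs , toList ys

ruleVal : ∀ {m n} → Rule m n → Val ruleTy
ruleVal r = toℕ (head r) , map encodeLiteral (body r)

gateVal-par : ∀ {m n} (g : Gate (Fin m)) → gateVal parVal g ≡ gateVal (encodeAtom {m} {n}) (mapG par g)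
gateVal-par (input _) = refl
gateVal-par (const _) = refl
gateVal-par (inv _)   = refl
gateVal-par (and _ _) = refl
gateVal-par (or _ _)  = refl

gateVal-encode : ∀ {m n} (g : Gate (Atom m n)) → gateVal encodeAtom g ≡ encodeGate g
gateVal-encode (input _) = refl
gateVal-encode (const _) = refl
gateVal-encode (inv _)   = refl
gateVal-encode (and _ _) = refl
gateVal-encode (or _ _)  = refl

-- A parameter and the atom `par` made from it have the same encoding, so passing from the pool to
-- the circuit for the theory requires no computation.
poolVal-par : ∀ {m n} (c : Gates (Fin m)) →
              poolVal parVal c ≡ poolVal (encodeAtom {m} {n}) (map (mapG par) c)
poolVal-par {m} {n} c =
  cong₂ _,_ (trans (map-cong gateVal-par c) (map-∘ c)) (sym (length-map (mapG (par {m} {n})) c))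

tailL : List ℕ → List ℕ
tailL []       = []
tailL (_ ∷ xs) = xs

headL : List ℕ → ℕ
headL []      = 0
headL (x ∷ _) = x

tailL-drop : ∀ k xs → tailL (drop k xs) ≡ drop (suc k) xs
tailL-drop zero    []       = refl
tailL-drop zero    (x ∷ xs) = refl
tailL-drop (suc k) []       = refl
tailL-drop (suc k) (x ∷ xs) = tailL-drop k xs

headL-drop : ∀ {n} (X : Vec ℕ n) q → headL (drop (toℕ q) (toList X)) ≡ lookup X q
headL-drop (x ∷ X) Fin.zero    = refl
headL-drop (x ∷ X) (Fin.suc q) = headL-drop X q

toList-replicate : ∀ n (r : ℕ) → List.replicate n r ≡ toList (replicate n r)
toList-replicate zero    r = refl
toList-replicate (suc n) r = cong (r ∷_) (toList-replicate n r)

ifZero : {X : Set} → X → X → ℕ → X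
ifZero a b zero    = a
ifZero a b (suc _) = b

ifZero-∸ : ∀ {n} (i j : Fin n) →
  ifZero (ifZero (inj₂ tt) (inj₁ tt) (toℕ j ∸ toℕ i)) (inj₁ tt) (toℕ i ∸ toℕ j) ≡
  encodeBool (does (i Fin.≟ j))
ifZero-∸ i j with i Fin.≟ j
... | yes refl rewrite n∸n≡0 (toℕ i) = refl
... | no i≢j with toℕ i ∸ toℕ j in p | toℕ j ∸ toℕ i in q
...   | suc _ | _     = refl
...   | zero  | suc _ = refl
...   | zero  | zero  =
  ⊥-elim (i≢j (toℕ-injective (≤-antisym (m∸n≡0⇒m≤n p) (m∸n≡0⇒m≤n q))))

module _ {m n : ℕ} {X : Set} (p : Fin m → Formula X) (d : Fin n → Formula X × Formula X) where

  -- Justifies using `layerT` for both bounds: the second component of the substitution is the first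
  -- one with the bounds exchanged.
  substitute-swap : ∀ φ → substitute p (swap ∘ d) φ ≡ swap (substitute p d φ)
  substitute-swap ff             = refl
  substitute-swap tt             = refl
  substitute-swap (atom (par q)) = refl
  substitute-swap (atom (def q)) = refl
  substitute-swap (∼ φ)          rewrite substitute-swap φ = refl
  substitute-swap (φ ⩓ ψ)        rewrite substitute-swap φ | substitute-swap ψ = refl
  substitute-swap (φ ⩔ ψ)        rewrite substitute-swap φ | substitute-swap ψ = refl

buildAll-cong : ∀ {k} {φ ψ : Fin k → Formula (Leaf I)} → φ ≗ ψ → ∀ c → buildAll φ c ≡ buildAll ψ c
buildAll-cong {k = zero}  h c = refl
buildAll-cong {k = suc k} h c rewrite h Fin.zero | buildAll-cong (h ∘ Fin.suc) c = refl

-- `buildAll` recurses on the number of atoms, the implementation on a list of their indices; this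
-- version links the two.
buildList : {X : Set} → (X → Formula (Leaf I)) → List X → Gates I → Gates I × List ℕ
buildList φ []       c = c , []
buildList φ (q ∷ qs) c =
  let (c₁ , rs) = buildList φ qs c
      (c₂ , r)  = build (φ q) c₁
  in c₂ , r ∷ rs

buildList-tabulate : ∀ {X : Set} {k} (φ : X → Formula (Leaf I)) (f : Fin k → X) c →
  buildList φ (List.tabulate f) c ≡
  (proj₁ (buildAll (φ ∘ f) c) , toList (proj₂ (buildAll (φ ∘ f) c)))
buildList-tabulate {k = zero}  φ f c = refl
buildList-tabulate {k = suc k} φ f c rewrite buildList-tabulate φ (f ∘ Fin.suc) c = refl

module Correctness (N : ℕ) where
  open Evaluation N

  private variable
    ε : Env Γ

  tail⇓ : {l : list nat ∈ Γ} (xs : List ℕ) → All.lookup ε l ≡ xs → length xs ≤ N →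
          ε ∋ tailT l ⇓ tailL xs
  tail⇓ xs p h = recList⇓ {Q = λ _ → ⊤} id tailL
    (var⇓ (trans p (sym (map-id xs)))) h (All.universal (λ _ → tt) xs) nil⇓
    (λ x xs _ → var⇓ (map-id xs))

  lookup⇓ : ∀ {n} {l : list nat ∈ Γ} {i : nat ∈ Γ} (X : Vec ℕ n) (q : Fin n) → n ≤ N →
            All.lookup ε l ≡ toList X → All.lookup ε i ≡ toℕ q →
            ε ∋ lookupT l i ⇓ lookup X q
  lookup⇓ {n = n} X q n≤N pX pq = ⇓-≡ (headL-drop X q)
    (recList⇓ {Q = λ _ → ⊤} id headL
      (⇓-≡ (sym (map-id _))
        (recNat⇓ (λ j → drop j (toList X)) (var⇓ pq) (≤-trans (<⇒≤ (toℕ<n q)) n≤N) (var⇓ pX)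
          (λ j _ → ⇓-≡ (tailL-drop j (toList X)) (tail⇓ (drop j (toList X)) refl (drop≤ j)))))
      (drop≤ (toℕ q)) (All.universal (λ _ → tt) _) zero⇓ (λ _ _ _ → var⇓ refl))
    where
    drop≤ : ∀ j → length (drop j (toList X)) ≤ N
    drop≤ j = begin
      length (drop j (toList X))   ≡⟨ length-drop j (toList X) ⟩
      length (toList X) ∸ j        ≤⟨ m∸n≤m _ j ⟩
      length (toList X)            ≡⟨ length-toList X ⟩
      n                            ≤⟨ n≤N ⟩
      N                            ∎
      where open ≤-Reasoning

  monus⇓ : ∀ {i j : nat ∈ Γ} a b → a ≤ N → b ≤ N → All.lookup ε i ≡ a → All.lookup ε j ≡ b →
           ε ∋ monusT i j ⇓ a ∸ b
  monus⇓ a b a≤N b≤N pa pb = recNat⇓ (a ∸_) (var⇓ pb) b≤N (var⇓ pa) λ k _ →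
    ⇓-≡ (pred[m∸n]≡m∸[1+n] a k)
      (recNat⇓ pred (var⇓ refl) (≤-trans (m∸n≤m a k) a≤N) zero⇓ (λ _ _ → var⇓ refl))

  equal⇓ : ∀ {n} {a b : nat ∈ Γ} (i j : Fin n) → n ≤ N →
           All.lookup ε a ≡ toℕ i → All.lookup ε b ≡ toℕ j →
           ε ∋ equalT a b ⇓ encodeBool (does (i Fin.≟ j))
  equal⇓ i j n≤N pi pj = ⇓-≡ (ifZero-∸ i j)
    (recNat⇓ (ifZero _ (inj₁ tt)) (monus⇓ _ _ i≤N j≤N pi pj) (≤-trans (m∸n≤m _ (toℕ j)) i≤N)
      (recNat⇓ (ifZero _ (inj₁ tt)) (monus⇓ _ _ j≤N i≤N pj pi) (≤-trans (m∸n≤m _ (toℕ i)) j≤N)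
        (inr⇓ unit⇓) (λ _ _ → inl⇓ unit⇓))
      (λ _ _ → inl⇓ unit⇓))
    where
    i≤N = ≤-trans (<⇒≤ (toℕ<n i)) n≤N
    j≤N = ≤-trans (<⇒≤ (toℕ<n j)) n≤N

  replicate⇓ : ∀ {i : nat ∈ Γ} {e} n r → n ≤ N → All.lookup ε i ≡ n →
               (∀ {rs k} → (rs ∷ k ∷ ε) ∋ e ⇓ r) →
               ε ∋ replicateT i e ⇓ toList (replicate n r)
  replicate⇓ n r n≤N pn pe = ⇓-≡ (toList-replicate n r)
    (recNat⇓ (λ k → List.replicate k r) (var⇓ pn) n≤N nil⇓ (λ _ _ → cons⇓ pe (var⇓ refl)))

  indices⇓ : ∀ {i : nat ∈ Γ} n → n ≤ N → All.lookup ε i ≡ n →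
             ε ∋ indicesT i ⇓ List.tabulate {n = n} toℕ
  indices⇓ n n≤N pn = recNat⇓ (λ k → List.tabulate {n = k} toℕ) (var⇓ pn) n≤N nil⇓ λ k k<n →
    cons⇓ zero⇓ (⇓-≡ (map-tabulate toℕ suc)
      (recList⇓ {Q = λ _ → ⊤} id (map suc) (var⇓ (sym (map-id _)))
        (≤-trans (≤-reflexive (length-tabulate {n = k} toℕ)) (≤-trans (<⇒≤ k<n) n≤N))
        (All.universal (λ _ → tt) _) nil⇓ (λ _ _ _ → cons⇓ (suc⇓ (var⇓ refl)) (var⇓ refl))))

  false⇓ : ε ∋ falseT ⇓ inj₂ (inj₁ (inj₁ tt))
  false⇓ = inr⇓ (inl⇓ (inl⇓ unit⇓))

  true⇓ : ε ∋ trueT ⇓ inj₂ (inj₁ (inj₂ tt))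
  true⇓ = inr⇓ (inl⇓ (inr⇓ unit⇓))

  inv⇓ : ∀ {e : Γ ⊢ nat} {r} → ε ∋ e ⇓ r → ε ∋ invT e ⇓ inj₂ (inj₂ (inj₁ r))
  inv⇓ p = inr⇓ (inr⇓ (inl⇓ p))

  and⇓ : ∀ {e f : Γ ⊢ nat} {r s} → ε ∋ e ⇓ r → ε ∋ f ⇓ s →
         ε ∋ andT e f ⇓ inj₂ (inj₂ (inj₂ (inj₁ (r , s))))
  and⇓ p q = inr⇓ (inr⇓ (inr⇓ (inl⇓ (pair⇓ p q))))

  or⇓ : ∀ {e f : Γ ⊢ nat} {r s} → ε ∋ e ⇓ r → ε ∋ f ⇓ s →
        ε ∋ orT e f ⇓ inj₂ (inj₂ (inj₂ (inj₂ (r , s))))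
  or⇓ p q = inr⇓ (inr⇓ (inr⇓ (inr⇓ (pair⇓ p q))))

  add⇓ : ∀ {e : Γ ⊢ gateTy} {i} (h : I → Val atomTy) g c → ε ∋ e ⇓ gateVal h g →
         All.lookup ε i ≡ poolVal h c → ε ∋ addT e i ⇓ builtVal h (add g c)
  add⇓ h g c p q = pair⇓
    (pair⇓ (cons⇓ p (fst⇓ (var⇓ q))) (suc⇓ (snd⇓ (var⇓ q))))
    (snd⇓ (var⇓ q))

  then⇓ : ∀ {e : Γ ⊢ A ⊗ B} {f : A ∷ A ⊗ B ∷ Γ ⊢ D} {v w} →
          ε ∋ e ⇓ v → (proj₁ v ∷ v ∷ ε) ∋ f ⇓ w → ε ∋ thenT e f ⇓ w
  then⇓ p q = bind⇓ p (bind⇓ (fst⇓ (var⇓ refl)) q)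

  module _ {m n : ℕ} (n≤N : n ≤ N) (X Y : Vec ℕ n) where

    private
      sub : Formula (Atom m n) → Formula (Leaf (Fin m))
      sub φ = proj₁ (substitute (atom ∘ inp)
                (λ r → atom (wire (lookup X r)) , atom (wire (lookup Y r))) φ)

    literal⇓ : ∀ {l : literalTy ∈ Γ} {xs ys i} L c → All.lookup ε l ≡ encodeLiteral L →
      All.lookup ε xs ≡ toList X → All.lookup ε ys ≡ toList Y →
      All.lookup ε i ≡ poolVal parVal c →
      ε ∋ literalT l xs ys i ⇓ builtVal parVal (build (sub (litF L)) c)
    literal⇓ (pos (par q)) c pl px py pc = case⇓₁ (var⇓ pl) (case⇓₁ (var⇓ refl)
      (add⇓ parVal (input q) c (inl⇓ (inl⇓ (var⇓ refl))) pc))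
    literal⇓ (pos (def q)) c pl px py pc = case⇓₁ (var⇓ pl) (case⇓₂ (var⇓ refl)
      (pair⇓ (var⇓ pc) (lookup⇓ X q n≤N px refl)))
    literal⇓ (neg (par q)) c pl px py pc = case⇓₂ (var⇓ pl) (case⇓₁ (var⇓ refl)
      (then⇓ (add⇓ parVal (input q) c (inl⇓ (inl⇓ (var⇓ refl))) pc)
        (add⇓ parVal (inv _) (input q ∷ c) (inv⇓ (snd⇓ (var⇓ refl))) refl)))
    literal⇓ (neg (def q)) c pl px py pc = case⇓₂ (var⇓ pl) (case⇓₂ (var⇓ refl)
      (add⇓ parVal (inv _) c (inv⇓ (lookup⇓ Y q n≤N py refl)) pc))

    body⇓ : ∀ {i : list literalTy ∈ Γ} {xs ys j} ls c → length ls ≤ N →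
      All.lookup ε i ≡ map encodeLiteral ls →
      All.lookup ε xs ≡ toList X → All.lookup ε ys ≡ toList Y →
      All.lookup ε j ≡ poolVal parVal c →
      ε ∋ bodyT i xs ys j ⇓ builtVal parVal (build (sub (⋀ (map litF ls))) c)
    body⇓ ls c ls≤N pl px py pc = recList⇓ {Q = λ _ → ⊤} encodeLiteral
      (λ ls → builtVal parVal (build (sub (⋀ (map litF ls))) c))
      (var⇓ pl) ls≤N (All.universal (λ _ → tt) ls) (add⇓ parVal (const true) c true⇓ pc)
      λ L ls _ → bind⇓ (fst⇓ (var⇓ refl))
        (then⇓ (literal⇓ L (tail ls) refl px py refl)
          (add⇓ parVal (and _ _) (proj₁ (build (sub (litF L)) (tail ls))) (and⇓ (snd⇓ (var⇓ refl)) (snd⇓ (var⇓ refl))) refl))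
      where
      tail : List (Literal m n) → Gates (Fin m)
      tail ls = proj₁ (build (sub (⋀ (map litF ls))) c)

    definition⇓ : ∀ {i : list ruleTy ∈ Γ} {k xs ys j} (P : Program m n) q c → length P ≤ N →
      All (λ r → length (body r) ≤ N) P →
      All.lookup ε i ≡ map ruleVal P → All.lookup ε k ≡ toℕ q →
      All.lookup ε xs ≡ toList X → All.lookup ε ys ≡ toList Y →
      All.lookup ε j ≡ poolVal parVal c →
      ε ∋ definitionT i k xs ys j ⇓ builtVal parVal (build (sub (φ[ P ] q)) c)
    definition⇓ {ε = ε} {i = i} {k} {xs} {ys} {j} P q c P≤N bodies≤N pP pq px py pc =
      recList⇓ ruleVal f (var⇓ pP) P≤N bodies≤N (add⇓ parVal (const false) c false⇓ pc) step
      where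
      f : Program m n → Val builtTy
      f P = builtVal parVal (build (sub (φ[ P ] q)) c)
      step : ∀ r P → length (body r) ≤ N → (f P ∷ ruleVal r ∷ map ruleVal P ∷ ε) ∋
             bind (fst (var v₁))
               (case (equalT v₀ (↑⁴ k)) (var v₂)
                 (bind (snd (var v₃)) (bind (fst (var v₃))
                   (thenT (bodyT v₁ (↑⁷ xs) (↑⁷ ys) v₀)
                     (addT (orT (snd (var v₁)) (snd (var v₆))) v₀))))) ⇓ f (r ∷ P)
      -- One abstraction resolves both the filter inside `φ[ P ] q` and the Boolean computed by
      -- `equalT`.
      step r P h with head r Fin.≟ q | equal⇓ {ε = toℕ (head r) ∷ f P ∷ ruleVal r ∷ map ruleVal P ∷ ε}
                                              {a = v₀} {b = ↑⁴ k} (head r) q n≤N refl pq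
      ... | no  _ | eq = bind⇓ (fst⇓ (var⇓ refl)) (case⇓₁ eq (var⇓ refl))
      ... | yes _ | eq = bind⇓ (fst⇓ (var⇓ refl)) (case⇓₂ eq
        (bind⇓ (snd⇓ (var⇓ refl)) (bind⇓ (fst⇓ (var⇓ refl))
          (then⇓ (body⇓ (body r) tail h refl px py refl)
            (add⇓ parVal (or _ _) (proj₁ (build (sub (⋀ (map litF (body r)))) tail)) (or⇓ (snd⇓ (var⇓ refl)) (snd⇓ (var⇓ refl))) refl)))))
        where tail = proj₁ (build (sub (φ[ P ] q)) c)

  module _ {m n : ℕ} (P : Program m n) (2n≤N : n + n ≤ N) (P≤N : length P ≤ N)
           (bodies≤N : All (λ r → length (body r) ≤ N) P) where

    private
      n≤N : n ≤ N
      n≤N = ≤-trans (m≤m+n n n) 2n≤N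

    layer⇓ : ∀ {qs : list nat ∈ Γ} {rs xs ys i} X Y c →
      All.lookup ε qs ≡ List.tabulate {n = n} toℕ → All.lookup ε rs ≡ map ruleVal P →
      All.lookup ε xs ≡ toList X → All.lookup ε ys ≡ toList Y →
      All.lookup ε i ≡ poolVal parVal c →
      ε ∋ layerT qs rs xs ys i ⇓ layerVal parVal (buildAll (proj₁ ∘ wired P X Y) c)
    layer⇓ X Y c pq pr px py pc =
      ⇓-≡ (cong (λ (c , rs) → poolVal parVal c , rs) (buildList-tabulate (proj₁ ∘ wired P X Y) id c))
        (recList⇓ {Q = λ _ → ⊤} toℕ f (var⇓ (trans pq (sym (map-tabulate id toℕ))))
          (≤-trans (≤-reflexive (length-tabulate {n = n} id)) n≤N)
          (All.universal (λ _ → tt) _) (pair⇓ (var⇓ pc) nil⇓)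
          λ q qs _ → bind⇓ (fst⇓ (var⇓ refl)) (bind⇓
            (definition⇓ n≤N X Y P q (proj₁ (buildList (proj₁ ∘ wired P X Y) qs c))
              P≤N bodies≤N pr refl px py refl)
            (pair⇓ (fst⇓ (var⇓ refl)) (cons⇓ (snd⇓ (var⇓ refl)) (snd⇓ (var⇓ refl))))))
      where
      f : List (Fin n) → Val (poolTy ⊗ list nat)
      f qs = let (c′ , rs) = buildList (proj₁ ∘ wired P X Y) qs c in poolVal parVal c′ , rs

    upperLayer⇓ : ∀ {qs : list nat ∈ Γ} {rs xs ys i} X Y c →
      All.lookup ε qs ≡ List.tabulate {n = n} toℕ → All.lookup ε rs ≡ map ruleVal P →
      All.lookup ε xs ≡ toList X → All.lookup ε ys ≡ toList Y →
      All.lookup ε i ≡ poolVal parVal c →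
      ε ∋ layerT qs rs ys xs i ⇓ layerVal parVal (buildAll (proj₂ ∘ wired P X Y) c)
    upperLayer⇓ X Y c pq pr px py pc =
      ⇓-≡ (cong (layerVal parVal) (buildAll-cong
            (λ q → cong proj₁ (substitute-swap (atom ∘ inp) _ (φ[ P ] q))) c))
        (layer⇓ Y X c pq pr py px pc)

    applied⇓ : ∀ {qs : list nat ∈ Γ} {rs i} S →
      All.lookup ε qs ≡ List.tabulate {n = n} toℕ → All.lookup ε rs ≡ map ruleVal P →
      All.lookup ε i ≡ stateVal S →
      ε ∋ appliedT qs rs i ⇓ stateVal (applied P S)
    applied⇓ (state c X Y) pq pr pS =
      bind⇓ (fst⇓ (var⇓ pS)) (bind⇓ (fst⇓ (snd⇓ (var⇓ pS))) (bind⇓ (snd⇓ (snd⇓ (var⇓ pS)))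
        (then⇓ (layer⇓ X Y c pq pr refl refl refl)
          (bind⇓ (upperLayer⇓ X Y (proj₁ (buildAll (proj₁ ∘ wired P X Y) c)) pq pr refl refl refl)
            (pair⇓ (fst⇓ (var⇓ refl)) (pair⇓ (snd⇓ (var⇓ refl)) (snd⇓ (var⇓ refl))))))))

    refounded⇓ : ∀ {k : nat ∈ Γ} {qs rs i} S → All.lookup ε k ≡ n →
      All.lookup ε qs ≡ List.tabulate {n = n} toℕ → All.lookup ε rs ≡ map ruleVal P →
      All.lookup ε i ≡ stateVal S →
      ε ∋ refoundedT k qs rs i ⇓ stateVal (refounded P S n)
    refounded⇓ (state c X Y) pn pq pr pS =
      bind⇓ (fst⇓ (var⇓ pS)) (bind⇓ (fst⇓ (snd⇓ (var⇓ pS))) (bind⇓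
        (recNat⇓ (λ k → layerVal parVal (iterated P X k c)) (var⇓ pn) n≤N
          (then⇓ (add⇓ parVal (const false) c false⇓ refl)
            (pair⇓ (var⇓ refl) (replicate⇓ n (length c) n≤N pn (snd⇓ (var⇓ refl)))))
          (λ k _ → then⇓ (var⇓ refl) (bind⇓ (snd⇓ (var⇓ refl))
            (upperLayer⇓ X (proj₂ (iterated P X k c)) (proj₁ (iterated P X k c)) pq pr refl refl refl))))
        (pair⇓ (fst⇓ (var⇓ refl)) (pair⇓ (var⇓ refl) (snd⇓ (var⇓ refl))))))

    initial⇓ : ∀ {k : nat ∈ Γ} → All.lookup ε k ≡ n → ε ∋ initialT k ⇓ stateVal (initial {m} {n})
    initial⇓ pn = bind⇓ (pair⇓ nil⇓ zero⇓)
      (then⇓ (add⇓ (parVal {m}) (const false) [] false⇓ refl)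
        (then⇓ (add⇓ (parVal {m}) (const true) (const false ∷ []) true⇓ refl)
          (pair⇓ (var⇓ refl) (pair⇓ (replicate⇓ n 0 n≤N pn (snd⇓ (var⇓ refl)))
                                    (replicate⇓ n 1 n≤N pn (snd⇓ (var⇓ refl)))))))

    compiled⇓ : ∀ {i j : nat ∈ Γ} {qs rs} → All.lookup ε i ≡ n → All.lookup ε j ≡ n + n →
      All.lookup ε qs ≡ List.tabulate {n = n} toℕ → All.lookup ε rs ≡ map ruleVal P →
      ε ∋ compiledT i j qs rs ⇓ stateVal (compiled P)
    compiled⇓ pn p2n pq pr = recNat⇓ (λ k → stateVal (roundTimes P k)) (var⇓ p2n) 2n≤N
      (initial⇓ pn)
      λ k _ → bind⇓
        (recNat⇓ (λ l → stateVal (appliedTimes P l (roundTimes P k))) (var⇓ p2n) 2n≤N (var⇓ refl)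
          (λ l _ → applied⇓ (appliedTimes P l (roundTimes P k)) pq pr refl))
        (refounded⇓ (appliedTimes P (n + n) (roundTimes P k)) pn pq pr refl)

    theory⇓ : ∀ {qs : list nat ∈ Γ} {xs i} (S : State m n) →
      All.lookup ε qs ≡ List.tabulate {n = n} toℕ →
      All.lookup ε xs ≡ toList (𝔖ₜ S) → All.lookup ε i ≡ poolVal parVal (pool S) →
      ε ∋ theoryT qs xs i ⇓
        builtVal (encodeAtom {m} {n}) (gates (theory S) , output (theory S))
    theory⇓ S pq px pc = recList⇓ {Q = λ _ → ⊤} toℕ f
      (var⇓ (trans pq (sym (map-tabulate id toℕ))))
      (≤-trans (≤-reflexive (length-tabulate {n = n} id)) n≤N)
      (All.universal (λ _ → tt) _)
      (add⇓ h (const true) (map (mapG par) (pool S)) true⇓ (trans pc (poolVal-par (pool S))))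
      λ q qs _ →
        let w  = lookup (𝔖ₜ S) q
            c₀ = proj₁ (g qs)
            c₁ = inv w ∷ c₀
            c₂ = input (def q) ∷ c₁
            c₃ = inv (length c₁) ∷ c₂
            c₄ = and (length c₂) (length c₀) ∷ c₃
            c₅ = input (def q) ∷ c₄
            c₆ = and (length c₄) w ∷ c₅
            c₇ = or (length c₅) (length c₃) ∷ c₆
        in bind⇓ (lookup⇓ (𝔖ₜ S) q n≤N px refl) (bind⇓ (fst⇓ (var⇓ refl))
          (then⇓ (add⇓ h (inv w) c₀ (inv⇓ (var⇓ refl)) refl)
          (then⇓ (add⇓ h (input (def q)) c₁ (inl⇓ (inr⇓ (var⇓ refl))) refl)
          (then⇓ (add⇓ h (inv _) c₂ (inv⇓ (snd⇓ (var⇓ refl))) refl)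
          (then⇓ (add⇓ h (and _ _) c₃ (and⇓ (snd⇓ (var⇓ refl)) (snd⇓ (var⇓ refl))) refl)
          (then⇓ (add⇓ h (input (def q)) c₄ (inl⇓ (inr⇓ (var⇓ refl))) refl)
          (then⇓ (add⇓ h (and _ _) c₅ (and⇓ (snd⇓ (var⇓ refl)) (var⇓ refl)) refl)
          (then⇓ (add⇓ h (or _ _) c₆ (or⇓ (snd⇓ (var⇓ refl)) (snd⇓ (var⇓ refl))) refl)
          (add⇓ h (and _ _) c₇ (and⇓ (snd⇓ (var⇓ refl)) (snd⇓ (var⇓ refl))) refl)))))))))
      where
      h : Atom m n → Val atomTy
      h = encodeAtom
      g : List (Fin n) → Gates (Atom m n) × ℕ
      g qs = build (⋀ (map (λ q → atom (inp (def q)) ⇿ atom (wire (lookup (𝔖ₜ S) q))) qs))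
                   (map (mapG par) (pool S))
      f : List (Fin n) → Val builtTy
      f qs = builtVal h (g qs)

    implementation⇓ : (encodeProgram P ∷ []) ∋ implementation ⇓ encodeCircuit (theory (compiled P))
    implementation⇓ =
      bind⇓ (fst⇓ (snd⇓ (var⇓ refl)))
        (bind⇓ (snd⇓ (snd⇓ (var⇓ refl)))
          (bind⇓ (recNat⇓ (_+ n) (var⇓ refl) n≤N (var⇓ refl) (λ _ _ → suc⇓ (var⇓ refl)))
            (bind⇓ (indices⇓ n n≤N refl)
              (bind⇓ (compiled⇓ refl refl refl refl)
                (bind⇓ (fst⇓ (var⇓ refl))
                  (bind⇓ (fst⇓ (snd⇓ (var⇓ refl)))
                    (bind⇓ (theory⇓ (compiled P) refl refl refl)
                      (⇓-≡ (cong (_, output (theory (compiled P)))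
                             (map-cong gateVal-encode (gates (theory (compiled P)))))
                        (pair⇓ (fst⇓ (fst⇓ (var⇓ refl))) (snd⇓ (var⇓ refl)))))))))))

    -- Stated for a variable e, since comparing the two sides for the concrete
    -- term would make Agda execute it symbolically.
    run-implementation : ∀ e {C : Circuit (Atom m n)} →
      (encodeProgram P ∷ []) ∋ e ⇓ encodeCircuit C →
      resultOn e P ≡ encodeCircuit C × timeOn e P ≤ costBound N e
    run-implementation e d = result≡ d , cost≤ d

    implementation-correct : resultOn implementation P ≡ encodeCircuit (theory (compiled P)) ×
                             timeOn implementation P ≤ costBound N implementation
    implementation-correct = run-implementation implementation implementation⇓

-- Bounds in the size of the program

length≤rulesSize : ∀ {m n} (P : Program m n) → length P ≤ rulesSize P
length≤rulesSize []      = z≤n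
length≤rulesSize (r ∷ P) = s≤s (≤-trans (length≤rulesSize P) (m≤n+m _ (length (body r))))

bodies≤rulesSize : ∀ {m n} (P : Program m n) → All (λ r → length (body r) ≤ rulesSize P) P
bodies≤rulesSize []      = []
bodies≤rulesSize (r ∷ P) =
  ≤-trans (n≤1+n _) (m≤m+n (suc (length (body r))) (rulesSize P)) ∷
  All.map (λ h → ≤-trans h (m≤n+m (rulesSize P) (suc (length (body r))))) (bodies≤rulesSize P)

n≤sizeP : ∀ {m n} (P : Program m n) → n ≤ sizeP P
n≤sizeP {m} {n} P = ≤-trans (m≤n+m n m) (m≤m+n (m + n) _)

rulesSize≤sizeP : ∀ {m n} (P : Program m n) → rulesSize P ≤ sizeP P
rulesSize≤sizeP {m} {n} P =
  ≤-trans (m≤n+m (rulesSize P) (m + n)) (≤-reflexive (sym (sizeP≡ P)))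

stepsBound layerBound sizeBound : ℕ → ℕ
stepsBound s = (s + s) * (suc s + (s + s)) + (s + s)
layerBound s = s * (1 + s * 6)
sizeBound  s = (1 + s * 20) + (2 + stepsBound s * (1 + (layerBound s + layerBound s)))

stepsBound-mono : ∀ {n s} → n ≤ s → stepsBound n ≤ stepsBound s
stepsBound-mono h =
  +-mono-≤ (*-mono-≤ (+-mono-≤ h h) (+-mono-≤ (s≤s h) (+-mono-≤ h h))) (+-mono-≤ h h)

output-sizeBound : ∀ {m n} (P : Program m n) {S} (ρ : Run P S) →
                   steps ρ ≤ stepsBound n → sizeC (theory S) ≤ sizeBound (sizeP P)
output-sizeBound {n = n} P {S} ρ h = ≤-trans (output-size ρ)
  (+-mono-≤ (s≤s (*-monoˡ-≤ 20 (n≤sizeP P)))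
    (s≤s (s≤s (*-mono-≤ (≤-trans h (stepsBound-mono (n≤sizeP P)))
                        (s≤s (+-mono-≤ layer≤ layer≤))))))
  where
  open Sizes P
  layer≤ : layer ≤ layerBound (sizeP P)
  layer≤ = *-mono-≤ (n≤sizeP P) (s≤s (*-monoˡ-≤ 6 (rulesSize≤sizeP P)))

double-polynomial : Polynomial (λ s → s + s)
double-polynomial = +-polynomial {id} {id} id-polynomial id-polynomial

stepsBound-polynomial : Polynomial stepsBound
stepsBound-polynomial =
  +-polynomial {λ s → (s + s) * (suc s + (s + s))}
    (*-polynomial {λ s → s + s} double-polynomial
      (+-polynomial {suc} (+-polynomial {λ _ → 1} (const-polynomial 1) id-polynomial)
        double-polynomial))
    double-polynomial

sizeBound-polynomial : Polynomial sizeBound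
sizeBound-polynomial =
  +-polynomial {λ s → 1 + s * 20}
    (+-polynomial {λ _ → 1} (const-polynomial 1) (scale 20))
    (+-polynomial {λ _ → 2} (const-polynomial 2)
      (*-polynomial {stepsBound} stepsBound-polynomial
        (+-polynomial {λ _ → 1} (const-polynomial 1) (+-polynomial {layerBound} layers layers))))
  where
  scale : ∀ a → Polynomial (_* a)
  scale a = *-polynomial {id} id-polynomial (const-polynomial a)
  layers : Polynomial layerBound
  layers = *-polynomial {id} id-polynomial (+-polynomial {λ _ → 1} (const-polynomial 1) (scale 6))

common-poly : ∀ {f g} → Polynomial f → Polynomial g →
              ∃[ c ] ∃[ k ] (∀ s → f s ≤ poly c k s × g s ≤ poly c k s)
common-poly {f} {g} pf pg =
  let (c , k , h) = Polynomial⇒poly (+-polynomial {f} {g} pf pg)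
  in c , k , λ s → ≤-trans (m≤m+n (f s) (g s)) (h s) , ≤-trans (m≤n+m (g s) (f s)) (h s)

timeBound : ℕ → ℕ
timeBound s = costBound (s + s) implementation

compiler-correct : ∀ {m n} (P : Program m n) →
  resultOn implementation P ≡ encodeCircuit (theory (compiled P)) ×
  timeOn implementation P ≤ timeBound (sizeP P)
compiler-correct {m} {n} P =
  Correctness.implementation-correct (s + s) {m} {n} P (+-mono-≤ (n≤sizeP P) (n≤sizeP P))
    (≤-trans (length≤rulesSize P) r≤2s)
    (All.map (λ h → ≤-trans h r≤2s) (bodies≤rulesSize P))
  where
  s = sizeP P
  r≤2s : rulesSize P ≤ s + s
  r≤2s = ≤-trans (rulesSize≤sizeP P) (m≤m+n s s)

abstract
  -- The theorem uses these constants only through the inequalities; `abstract` keeps the numbers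
  -- read off the term from being unfolded.
  compiler-poly : ∃[ c ] ∃[ k ] (∀ s → timeBound s ≤ poly c k s × sizeBound s ≤ poly c k s)
  compiler-poly = common-poly {timeBound} {sizeBound}
    (costBound-polynomial double-polynomial implementation) sizeBound-polynomial

  run-poly : ∃[ c ] ∃[ k ] (∀ s → stepsBound s ≤ poly c k s × sizeBound s ≤ poly c k s)
  run-poly = common-poly {stepsBound} {sizeBound} stepsBound-polynomial sizeBound-polynomial

theorem5p1 : (Σ[ e ∈ Implementation ] ∃[ c ] ∃[ k ]
    (∀ {m n : ℕ} (P : Program m n) →
    Σ[ C ∈ Circuit (Atom m n) ]
    Compile P C
    × resultOn e P ≡ encodeCircuit C
    × timeOn e P ≤ poly c k (sizeP P)
    × sizeC C ≤ poly c k (sizeP P)))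
    × (∃[ c ] ∃[ k ]
    (∀ {m n : ℕ} (P : Program m n) (S : State m n) (ρ : Run P S) → Economical ρ →
    steps ρ ≤ poly c k (sizeP P)
    × sizeC (theory S) ≤ poly c k (sizeP P)))
theorem5p1 =
  (implementation , proj₁ compiler-poly , proj₁ (proj₂ compiler-poly) , λ {m} {n} P →
    let open CompleteRun P
        (time≤ , size≤) = proj₂ (proj₂ compiler-poly) (sizeP P)
        (correct , fast) = compiler-correct P
        -- The summand `n + n` of `stepsBound` allows for applications after the last round; the run
        -- of the implementation ends with a round.
        steps≤ = ≤-trans (≤-reflexive compiled-steps) (m≤m+n _ (n + n))
    in theory (compiled P) , compile-complete , correct ,
       ≤-trans fast time≤ , ≤-trans (output-sizeBound P compiled-run steps≤) size≤) ,
  (proj₁ run-poly , proj₁ (proj₂ run-poly) , λ P S ρ economical →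
    let (steps-poly , size≤) = proj₂ (proj₂ run-poly) (sizeP P)
        steps≤ = Sizes.economical-steps P ρ economical
    in ≤-trans (≤-trans steps≤ (stepsBound-mono (n≤sizeP P))) steps-poly ,
       ≤-trans (output-sizeBound P ρ steps≤) size≤)
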